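{- For all integers $r\ge 1$ and $n\ge 0$, $$\beta_n^{(r)}=\sum_{k=0}^{n}\varphi_r(q,k)\,S_q(n,k),$$ where, for all integers $k\ge 0$, $$\varphi_r(q,k)=(-1)^k[k]!\sum_{i=0}^{r-1}q^{ik}\frac{[r-1]_i}{[k+r]_{i+1}}=(-1)^k[k]!\,[r-1]!\,q^{ -r+1}\sum_{i=0}^{r-1}\frac{(q-1)^i\,q^{\frac12 i(i+1)-i(r-1)}}{[r-1-i]!}\,\frac{1}{[k+i+1]}$$ (in particular, the two expressions given for $\varphi_r(q,k)$ are equal).
   Context: Let $q$ be a positive real number, $q\neq 1$, and put $[X]:=\frac{q^X-1}{q-1}$. For an integer $k\ge 0$, $[X]_k:=[X][X-1]\cdots[X-k+1]$ (with $[X]_0=1$), and $[k]!:=[k]_k=[k][k-1]\cdots[1]$. The $q$-Stirling numbers of the second kind $S_q(n,k)$ ($n\ge k\ge 0$) are defined by the identities $$[X]^n=\sum_{k=0}^{n}q^{\frac12 k(k-1)}S_q(n,k)\,[X]_k\qquad(n\ge 0).$$ For integers $n\ge 0$ let $$\eta_n(X):=(q-1)^{ -n}\sum_{k=0}^{n}(-1)^{n-k}\binom{n}{k}\frac{k}{[k]}\,q^{kX},$$ with the convention $\frac{k}{[k]}=1$ for $k=0$. The extended Carlitz $q$-Bernoulli polynomials $\beta_n^{(r)}(X)$ ($r,n\ge 0$ integers) are defined recursively by $\beta_n^{(0)}(X):=\eta_n(X)$ and $$\beta_n^{(r+1)}(X):=q^{ -X}\left(\beta_n^{(r)}(X)+(q-1)\beta_{n+1}^{(r)}(X)\right),$$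 and $\beta_n^{(r)}:=\beta_n^{(r)}(0)$. -}

module Defs where

open import Algebra.Apartness.Bundles using (HeytingField; HeytingCommutativeRing)
open import Algebra.Bundles using (CommutativeRing; Semiring)
import Algebra.Apartness.Properties.HeytingCommutativeRing as HCRProperties
import Algebra.Properties.CommutativeMonoid.Sum as SumProperties
import Algebra.Properties.Ring as RingProperties
import Algebra.Definitions.RawSemiring as RawSemiringDefs
open import Data.Fin.Base using (Fin; toℕ)
open import Data.Fin.Properties using (toℕ<n)
open import Data.Nat.Base as ℕ using (ℕ; zero; suc; _∸_)
open import Data.Nat.Combinatorics using (_C_)
open import Data.Nat.DivMod using () renaming (_/_ to _div_)
open import Data.Nat.Properties using (≤-trans; m≤n+m; n≤1+n; +-suc; m≤n⇒∃[o]m+o≡n) renaming (≤-refl to ℕ-≤-refl)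
open import Data.Product.Base using (∃; _,_; proj₁; proj₂) renaming (_×_ to _∧_)
open import Data.Sum.Base using (_⊎_; inj₁; inj₂; [_,_]′)
open import Level using (_⊔_) renaming (suc to lsuc)
open import Relation.Binary.Core using (Rel)
open import Relation.Binary.Structures using (IsStrictPartialOrder)
import Relation.Binary.PropositionalEquality.Core as ≡
import Relation.Binary.Reasoning.Setoid as ≈-Reasoning

-- The real numbers, axiomatised as a Cauchy-complete Archimedean ordered
-- (Heyting) field; these axioms determine ℝ up to isomorphism.  The apartness
-- x # y ("x < y or y < x") is the constructive reading of x ≠ y.  The
-- operation pow is a ↦ aˣ for a > 0 and real x; for each a the pow-laws have
-- exactly one solution.
record RealNumbers c ℓ₁ ℓ₂ : Set (lsuc (c ⊔ ℓ₁ ⊔ ℓ₂)) where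
  infix 4 _<_ _ConvergesTo_
  field
    heytingField : HeytingField c ℓ₁ ℓ₂

  open HeytingField heytingField public

  commutativeRing : CommutativeRing c ℓ₁
  commutativeRing = HeytingCommutativeRing.commutativeRing heytingCommutativeRing

  open CommutativeRing commutativeRing public
    using (+-commutativeMonoid; semiring; ring)
  open RawSemiringDefs (Semiring.rawSemiring semiring) public using (_^_) renaming (_×_ to _·_)
  open SumProperties +-commutativeMonoid public using (sum-syntax; sum⁺-syntax)

  ι : ℕ → Carrier
  ι n = n · 1#

  field
    _<_                  : Rel Carrier ℓ₂
    <-isStrictPartialOrder : IsStrictPartialOrder _≈_ _<_
    #⇒<⊎>                : ∀ {x y} → x # y → x < y ⊎ y < x
    <⇒#                  : ∀ {x y} → x < y → x # y
    +-monoˡ-<            : ∀ z {x y} → x < y → x + z < y + z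
    *-pos                : ∀ {x y} → 0# < x → 0# < y → 0# < x * y
    archimedean          : ∀ x → ∃ λ n → x < ι n

  Cauchy : (ℕ → Carrier) → Set (c ⊔ ℓ₂)
  Cauchy s = ∀ ε → 0# < ε → ∃ λ N → ∀ m n → N ℕ.≤ m → N ℕ.≤ n → s m < s n + ε

  _ConvergesTo_ : (ℕ → Carrier) → Carrier → Set (c ⊔ ℓ₂)
  s ConvergesTo l =
    ∀ ε → 0# < ε → ∃ λ N → ∀ n → N ℕ.≤ n → (s n < l + ε) ∧ (l < s n + ε)

  field
    complete : ∀ s → Cauchy s → ∃ λ l → s ConvergesTo l

    pow      : ∀ a → 0# < a → Carrier → Carrier
    pow-cong : ∀ {a b} (a>0 : 0# < a) (b>0 : 0# < b) {x y} →
               a ≈ b → x ≈ y → pow a a>0 x ≈ pow b b>0 y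
    pow-+    : ∀ {a} (a>0 : 0# < a) x y →
               pow a a>0 (x + y) ≈ pow a a>0 x * pow a a>0 y
    pow-1    : ∀ {a} (a>0 : 0# < a) → pow a a>0 1# ≈ a
    1-pow    : ∀ (1>0 : 0# < 1#) x → pow 1# 1>0 x ≈ 1#
    pow-mono : ∀ {a} (a>0 : 0# < a) → 1# < a →
               ∀ {x y} → x < y → pow a a>0 x < pow a a>0 y
    pow-anti : ∀ {a} (a>0 : 0# < a) → a < 1# →
               ∀ {x y} → x < y → pow a a>0 y < pow a a>0 x

  -- The witness satisfies (x - 0#) * inv ≈ 1#, where x - 0# ≈ x.
  inv : ∀ {x} → x # 0# → Carrier
  inv x#0 = proj₁ (#⇒invertible x#0)

module RealProperties {c ℓ₁ ℓ₂} (ℝ : RealNumbers c ℓ₁ ℓ₂) where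
  open RealNumbers ℝ
  open HCRProperties heytingCommutativeRing public
  open RingProperties ring using (-‿distribˡ-*; -‿involutive; -‿anti-homo-+)
  open IsStrictPartialOrder <-isStrictPartialOrder public
    using (<-respʳ-≈; <-respˡ-≈) renaming (trans to <-trans)

  x#y⇒x-y#0 : ∀ {x y} → x # y → x - y # 0#
  x#y⇒x-y#0 {x} {y} x#y with #⇒invertible x#y
  ... | z , z*[x-y]≈1 , _ =
    invertibleˡ⇒# (z , trans (*-congˡ (x-0≈x (x - y))) z*[x-y]≈1)

  inv#0 : ∀ {x} (x#0 : x # 0#) → inv x#0 # 0#
  inv#0 {x} x#0 = invertibleˡ⇒#
    (x - 0# , trans (*-congˡ (x-0≈x _)) (proj₂ (proj₂ (#⇒invertible x#0))))

  *-invʳ : ∀ {x} (x#0 : x # 0#) → x * inv x#0 ≈ 1#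
  *-invʳ {x} x#0 =
    trans (*-congʳ (sym (x-0≈x x))) (proj₂ (proj₂ (#⇒invertible x#0)))

  0<1 : 0# < 1#
  0<1 = [ (λ 1<0 → <-respʳ-≈ -1*-1≈1 (*-pos (0<-1 1<0) (0<-1 1<0))) , (λ 0<1 → 0<1) ]′
        (#⇒<⊎> 1#0)
    where
    0<-1 : 1# < 0# → 0# < - 1#
    0<-1 1<0 = <-respˡ-≈ (-‿inverseʳ 1#) (<-respʳ-≈ (+-identityˡ _) (+-monoˡ-< (- 1#) 1<0))
    -1*-1≈1 : - 1# * - 1# ≈ 1#
    -1*-1≈1 = trans (sym (-‿distribˡ-* 1# (- 1#)))
                (trans (-‿cong (*-identityˡ _)) (-‿involutive 1#))

  0<ι[1+n] : ∀ n → 0# < ι (suc n)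
  0<ι[1+n] zero    = <-respʳ-≈ (sym (+-identityʳ 1#)) 0<1
  0<ι[1+n] (suc n) = <-trans (0<ι[1+n] n)
    (<-respˡ-≈ (+-identityˡ _) (+-monoˡ-< (ι (suc n)) 0<1))

  ι-∸ : ∀ m d → ι (m ℕ.+ d) - ι m ≈ ι d
  ι-∸ zero    d = x-0≈x (ι d)
  ι-∸ (suc m) d = begin
    1# + ι (m ℕ.+ d) - (1# + ι m)         ≈⟨ +-congˡ (-‿anti-homo-+ 1# (ι m)) ⟩
    1# + ι (m ℕ.+ d) + (- ι m - 1#)       ≈⟨ +-assoc _ _ _ ⟨
    1# + ι (m ℕ.+ d) - ι m - 1#           ≈⟨ +-congʳ (+-assoc _ _ _) ⟩
    1# + (ι (m ℕ.+ d) - ι m) - 1#         ≈⟨ +-congʳ (+-congˡ (ι-∸ m d)) ⟩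
    1# + ι d - 1#                         ≈⟨ +-congʳ (+-comm _ _) ⟩
    ι d + 1# - 1#                         ≈⟨ +-assoc _ _ _ ⟩
    ι d + (1# - 1#)                       ≈⟨ +-congˡ (-‿inverseʳ 1#) ⟩
    ι d + 0#                              ≈⟨ +-identityʳ _ ⟩
    ι d                                   ∎
    where
    open ≈-Reasoning setoid

  pow-0 : ∀ {a} (a>0 : 0# < a) → pow a a>0 0# ≈ 1#
  pow-0 {a} a>0 = begin
    p 0#                    ≈⟨ *-identityʳ _ ⟨
    p 0# * 1#               ≈⟨ *-congˡ (*-invʳ a#0) ⟨
    p 0# * (a * inv a#0)    ≈⟨ *-assoc _ _ _ ⟨
    p 0# * a * inv a#0      ≈⟨ *-congʳ (*-congˡ (pow-1 a>0)) ⟨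
    p 0# * p 1# * inv a#0   ≈⟨ *-congʳ (pow-+ a>0 0# 1#) ⟨
    p (0# + 1#) * inv a#0   ≈⟨ *-congʳ (pow-cong a>0 a>0 refl (+-identityˡ 1#)) ⟩
    p 1# * inv a#0          ≈⟨ *-congʳ (pow-1 a>0) ⟩
    a * inv a#0             ≈⟨ *-invʳ a#0 ⟩
    1#                      ∎
    where
    open ≈-Reasoning setoid
    p = pow a a>0
    a#0 = #-sym (<⇒# a>0)

module QAnalogues {c ℓ₁ ℓ₂} (ℝ : RealNumbers c ℓ₁ ℓ₂)
                  (q : RealNumbers.Carrier ℝ)
                  (q>0 : RealNumbers._<_ ℝ (RealNumbers.0# ℝ) q)
                  (q#1 : RealNumbers._#_ ℝ q (RealNumbers.1# ℝ)) where
  open RealNumbers ℝ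
  open RealProperties ℝ

  infix 9 q^_

  q^_ : Carrier → Carrier
  q^ X = pow q q>0 X

  q-1#0 : q - 1# # 0#
  q-1#0 = x#y⇒x-y#0 q#1

  [_] : Carrier → Carrier
  [ X ] = (q^ X - 1#) * inv q-1#0

  -- [ X ]↓ k is [X]ₖ = [X][X-1]⋯[X-k+1].
  [_]↓_ : Carrier → ℕ → Carrier
  [ X ]↓ zero    = 1#
  [ X ]↓ (suc k) = [ X ]↓ k * [ X - ι k ]

  [_]! : ℕ → Carrier
  [ k ]! = [ ι k ]↓ k

  []-cong : ∀ {X Y} → X ≈ Y → [ X ] ≈ [ Y ]
  []-cong X≈Y = *-congʳ (+-congʳ (pow-cong q>0 q>0 refl X≈Y))

  [1+n]#0 : ∀ n → [ ι (suc n) ] # 0#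
  [1+n]#0 n = x#0y#0→xy#0 (x#y⇒x-y#0 q^[1+n]#1) (inv#0 q-1#0)
    where
    q^[1+n]#1 : q^ (ι (suc n)) # 1#
    q^[1+n]#1 = #-congˡ (pow-0 q>0)
      ([ (λ q<1 → <⇒# (pow-anti q>0 q<1 (0<ι[1+n] n)))
       , (λ 1<q → #-sym (<⇒# (pow-mono q>0 1<q (0<ι[1+n] n)))) ]′ (#⇒<⊎> q#1))

  [n]↓m#0 : ∀ {m n} → m ℕ.≤ n → [ ι n ]↓ m # 0#
  [n]↓m#0 {zero}          _   = 1#0
  [n]↓m#0 {suc m} {n} m<n =
    x#0y#0→xy#0 ([n]↓m#0 (≤-trans (n≤1+n m) m<n)) (factor m<n)
    where
    factor : suc m ℕ.≤ n → [ ι n - ι m ] # 0#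
    factor m<n with m≤n⇒∃[o]m+o≡n m<n
    ... | d , ≡.refl = #-congʳ
      ([]-cong (sym (≡.subst (λ j → ι j - ι m ≈ ι (suc d)) (+-suc m d) (ι-∸ m (suc d)))))
      ([1+n]#0 d)

  [n]!#0 : ∀ n → [ n ]! # 0#
  [n]!#0 n = [n]↓m#0 {n} {n} ℕ-≤-refl

  -- S n k is the q-Stirling number S_q(n,k).  The identities are required for
  -- every real X; they only involve, and uniquely determine, S n k for k ≤ n.
  IsqStirling₂ : (ℕ → ℕ → Carrier) → Set (c ⊔ ℓ₁)
  IsqStirling₂ S = ∀ n X →
    [ X ] ^ n ≈ ∑[ k ≤ n ] (let k = toℕ k in
      q^ (ι ((k ℕ.* (k ∸ 1)) div 2)) * S n k * [ X ]↓ k)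

  k/[k] : ℕ → Carrier
  k/[k] zero    = 1#
  k/[k] (suc k) = ι (suc k) * inv ([1+n]#0 k)

  η : ℕ → Carrier → Carrier
  η n X = inv q-1#0 ^ n * ∑[ k ≤ n ] (let k = toℕ k in
    (- 1#) ^ (n ∸ k) * ι (n C k) * k/[k] k * q^ (ι k * X))

  -- β r n X is βₙ⁽ʳ⁾(X).
  β : ℕ → ℕ → Carrier → Carrier
  β zero    n X = η n X
  β (suc r) n X = q^ (- X) * (β r n X + (q - 1#) * β r (suc n) X)

  -- The two expressions for φᵣ(q,k), r ≥ 1; the denominators [k+r]_{i+1},
  -- [r-1-i]! and [k+i+1] are given by the types of the apartness proofs.
  φ : ℕ → ℕ → Carrier
  φ r k = (- 1#) ^ k * [ k ]! * ∑[ i < r ] (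
      q^ (ι (toℕ i ℕ.* k)) * [ ι r - 1# ]↓ toℕ i * inv ([k+r]↓[1+i]#0 i))
    where
    [k+r]↓[1+i]#0 : (i : Fin r) → [ ι (k ℕ.+ r) ]↓ suc (toℕ i) # 0#
    [k+r]↓[1+i]#0 i = [n]↓m#0 (≤-trans (toℕ<n i) (m≤n+m r k))

  φ′ : ℕ → ℕ → Carrier
  φ′ r k = (- 1#) ^ k * [ k ]! * [ r ∸ 1 ]! * q^ (- ι r + 1#) * ∑[ i < r ] (let i = toℕ i in
      (q - 1#) ^ i * q^ (ι ((i ℕ.* suc i) div 2) - ι i * (ι r - 1#))
        * inv ([n]!#0 (r ∸ 1 ∸ i)) * inv ([1+n]#0 (k ℕ.+ i)))

{-# OPTIONS --safe #-}
module Submission where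

-- At X = 0 the recursion for β says (q-1) βₙ₊₁⁽ʳ⁾ = βₙ⁽ʳ⁺¹⁾ - βₙ⁽ʳ⁾, so β₀⁽ʳ⁾ = r/[r]
-- (by finite differences) determines everything for r ≥ 1.  By the Stirling recurrence
-- S(n+1,k+1) = S(n,k) + [k+1] S(n,k+1), the sum Σ φᵣ(k) S(n,k) obeys the same recursion
-- once φᵣ(0) = r/[r] and φᵣ₊₁(k) = (q-1) φᵣ(k+1) + qᵏ φᵣ(k).
--
-- For φᵣ(k) = (-1)ᵏ [k]! Φᵣ(k) the latter reads Φᵣ₊₁(k) = (1-qᵏ⁺¹) Φᵣ(k+1) + qᵏ Φᵣ(k),
-- which follows by induction on r from [k+r+1] Φᵣ₊₁(k) = 1 + qᵏ [r] Φᵣ(k).  The second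
-- expression for φ satisfies it by partial fractions, so the two agree.

open import Defs
open import Algebra.Bundles using (CommutativeMonoid; CommutativeRing; RawRing)
import Algebra.Properties.AbelianGroup as AbelianGroupProperties
import Algebra.Properties.CommutativeSemigroup as CommutativeSemigroupProperties
import Algebra.Properties.Ring as RingProperties
import Algebra.Properties.Semiring.Mult as Mult
import Algebra.Properties.Semiring.Mult.TCOptimised as OptimisedMult
import Algebra.Properties.Semiring.Sum as SemiringSum
import Algebra.Solver.Ring as RingSolver
open import Algebra.Solver.Ring.AlmostCommutativeRing
  using (fromCommutativeRing; _-Raw-AlmostCommutative⟶_; Induced-equivalence)
open import Data.Fin.Base using (Fin; toℕ; suc)
open import Data.Fin.Properties using (toℕ<n)
open import Data.Maybe.Base using (Maybe; map)
open import Data.Nat.Base as ℕ using (ℕ; zero; suc; _≤_; _∸_; z≤n; s≤s)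
open import Data.Nat.Combinatorics using (_C_; nCk+nC[k+1]≡[n+1]C[k+1]; k>n⇒nCk≡0)
open import Data.Nat.Divisibility using (n∣m*n)
open import Data.Nat.DivMod using (+-distrib-/-∣ʳ; m*n/n≡m) renaming (_/_ to _div_)
open import Data.Nat.Induction using (<-rec)
import Data.Nat.Properties as ℕ
open import Data.Nat.Tactic.RingSolver using (solve-∀)
open import Data.Product.Base using (_×_; _,_)
open import Data.Product.Properties using (≡-dec)
open import Relation.Binary.Definitions using (tri<; tri≈; tri>)
open import Relation.Binary.PropositionalEquality as ≡ using (_≡_; _≢_)
import Relation.Binary.Reasoning.Setoid as ≈-Reasoning
open import Relation.Nullary.Decidable using (yes; no; dec⇒maybe)
open import Relation.Nullary.Negation using (contradiction)

-- The recursion required of `φ` is dictated by the Stirling recurrence. Moving that recurrence from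
-- S(n+1,k) onto the weights turns φᵣ(k) into φᵣ(k+1) + [k] φᵣ(k); multiplied by q-1, with (q-1)[k]
-- = qᵏ - 1, this must equal φᵣ₊₁(k) - φᵣ(k). The obstacle in the induction for Φ is its start: the
-- relation is false at r = 0, where Φ₀ = 0 but Φ₁(k) = 1/[k+1]. The inductive step, however, needs
-- the preceding relation only after multiplication by [r], and that product holds at r = 0 because
-- [0] = 0. For the second expression the decisive fact is that (q^(-i-1) - qᵏ)/[k+i+1] does not
-- depend on k. It trades multiples of 1/[k+i+1] for multiples of 1/[k+i+2], so that coefficients
-- free of k can satisfy a recursion whose multipliers contain k. The given Stirling numbers are
-- pinned down only for k ≤ n and only through an identity in X. The argument therefore runs with
-- recursively defined numbers, and uniqueness transfers the result at the end.

module DifferenceCoefficients {c ℓ} (R : CommutativeRing c ℓ) where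
  open CommutativeRing R
  open RingProperties ring using (-0#≈0#; -‿distribˡ-*; -‿distribʳ-*; -‿involutive)
  open AbelianGroupProperties +-abelianGroup using (⁻¹-∙-comm)
  open OptimisedMult semiring using (×-homo-+; ×1-homo-*) renaming (_×_ to _·_)
  open CommutativeSemigroupProperties (CommutativeMonoid.commutativeSemigroup +-commutativeMonoid) using (interchange)
  open ≈-Reasoning setoid

  -- Integer coefficients for the ring solver.

  ι : ℕ → Carrier
  ι n = n · 1#

  -- A pair stands for the integer a - b. Cancelling until one component is 0 gives a canonical
  -- form, so propositional equality of reduced pairs decides equality of the integers; equality in
  -- the ring itself need not be decidable.
  reduce : ℕ → ℕ → ℕ × ℕ
  reduce a       zero    = a , 0
  reduce zero    (suc b) = 0 , suc b
  reduce (suc a) (suc b) = reduce a b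

  coefficients : RawRing _ _
  coefficients = record
    { Carrier = ℕ × ℕ
    ; _≈_     = _≡_
    ; _+_     = λ (a , b) (c , d) → reduce (a ℕ.+ c) (b ℕ.+ d)
    ; _*_     = λ (a , b) (c , d) → reduce (a ℕ.* c ℕ.+ b ℕ.* d) (a ℕ.* d ℕ.+ b ℕ.* c)
    ; -_      = λ (a , b) → b , a
    ; 0#      = 0 , 0
    ; 1#      = 1 , 0
    }

  -- The split on the subtrahend makes the constants 0# and 1# denote
  -- themselves definitionally.
  value : ℕ × ℕ → Carrier
  value (a , zero)      = ι a
  value (a , b@(suc _)) = ι a - ι b

  value-diff : ∀ a b → value (a , b) ≈ ι a - ι b
  value-diff a zero    = sym (trans (+-congˡ -0#≈0#) (+-identityʳ (ι a)))
  value-diff a (suc b) = refl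

  diff-+ : ∀ a b c d → (a + c) - (b + d) ≈ (a - b) + (c - d)
  diff-+ a b c d = begin
    (a + c) - (b + d)      ≈⟨ +-congˡ (⁻¹-∙-comm b d) ⟨
    (a + c) + (- b - d)    ≈⟨ interchange a c (- b) (- d) ⟩
    (a - b) + (c - d)      ∎

  diff-* : ∀ a b c d → (a * c + b * d) - (a * d + b * c) ≈ (a - b) * (c - d)
  diff-* a b c d = begin
    (a * c + b * d) - (a * d + b * c)                  ≈⟨ diff-+ _ _ _ _ ⟩
    (a * c - a * d) + (b * d - b * c)                  ≈⟨ +-congˡ (+-comm _ _) ⟩
    (a * c - a * d) + (- (b * c) + b * d)              ≈⟨ +-congˡ (+-congˡ (-‿involutive _)) ⟨
    (a * c - a * d) + (- (b * c) - - (b * d))          ≈⟨ +-cong (+-congˡ (-‿distribʳ-* a d))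
                                                           (+-cong (-‿distribˡ-* b c) (trans (-‿cong (-‿distribʳ-* b d)) (-‿distribˡ-* b (- d)))) ⟩
    (a * c + a * - d) + (- b * c + - b * - d)          ≈⟨ +-cong (distribˡ a c (- d)) (distribˡ (- b) c (- d)) ⟨
    a * (c - d) + - b * (c - d)                        ≈⟨ distribʳ (c - d) a (- b) ⟨
    (a - b) * (c - d)                                  ∎

  value-reduce : ∀ a b → value (reduce a b) ≈ ι a - ι b
  value-reduce a       zero    = value-diff a 0
  value-reduce zero    (suc b) = refl
  value-reduce (suc a) (suc b) = begin
    value (reduce a b)             ≈⟨ value-reduce a b ⟩
    ι a - ι b                      ≈⟨ +-identityˡ _ ⟨
    0# + (ι a - ι b)               ≈⟨ +-congʳ (-‿inverseʳ 1#) ⟨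
    (1# - 1#) + (ι a - ι b)        ≈⟨ diff-+ _ _ _ _ ⟨
    (1# + ι a) - (1# + ι b)        ≈⟨ +-cong (×-homo-+ 1# 1 a) (-‿cong (×-homo-+ 1# 1 b)) ⟨
    ι (suc a) - ι (suc b)          ∎

  morphism : coefficients -Raw-AlmostCommutative⟶ fromCommutativeRing R
  morphism = record
    { ⟦_⟧    = value
    ; +-homo = λ (a , b) (c , d) → begin
        value (reduce (a ℕ.+ c) (b ℕ.+ d)) ≈⟨ value-reduce _ (b ℕ.+ d) ⟩
        ι (a ℕ.+ c) - ι (b ℕ.+ d)          ≈⟨ +-cong (×-homo-+ 1# a c) (-‿cong (×-homo-+ 1# b d)) ⟩
        (ι a + ι c) - (ι b + ι d)          ≈⟨ diff-+ _ _ _ _ ⟩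
        (ι a - ι b) + (ι c - ι d)          ≈⟨ +-cong (value-diff a b) (value-diff c d) ⟨
        value (a , b) + value (c , d)      ∎
    ; *-homo = λ (a , b) (c , d) → begin
        value (reduce (a ℕ.* c ℕ.+ b ℕ.* d) (a ℕ.* d ℕ.+ b ℕ.* c))
                                                                ≈⟨ value-reduce _ (a ℕ.* d ℕ.+ b ℕ.* c) ⟩
        ι (a ℕ.* c ℕ.+ b ℕ.* d) - ι (a ℕ.* d ℕ.+ b ℕ.* c)       ≈⟨ +-cong (ι-inner a c b d) (-‿cong (ι-inner a d b c)) ⟩
        (ι a * ι c + ι b * ι d) - (ι a * ι d + ι b * ι c)       ≈⟨ diff-* _ _ _ _ ⟩
        (ι a - ι b) * (ι c - ι d)                               ≈⟨ *-cong (value-diff a b) (value-diff c d) ⟨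
        value (a , b) * value (c , d)                           ∎
    ; -‿homo = λ (a , b) → begin
        value (b , a)          ≈⟨ value-diff b a ⟩
        ι b - ι a              ≈⟨ +-comm _ _ ⟩
        - ι a + ι b            ≈⟨ +-congˡ (-‿involutive _) ⟨
        - ι a - - ι b          ≈⟨ ⁻¹-∙-comm _ _ ⟩
        - (ι a - ι b)          ≈⟨ -‿cong (value-diff a b) ⟨
        - value (a , b)        ∎
    ; 0-homo = refl
    ; 1-homo = refl
    }
    where
    ι-inner : ∀ a b c d → ι (a ℕ.* b ℕ.+ c ℕ.* d) ≈ ι a * ι b + ι c * ι d
    ι-inner a b c d = trans (×-homo-+ 1# (a ℕ.* b) (c ℕ.* d)) (+-cong (×1-homo-* a b) (×1-homo-* c d))

  _≟ᶜ_ : ∀ x y → Maybe (Induced-equivalence morphism x y)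
  x ≟ᶜ y = map (λ x≡y → reflexive (≡.cong value x≡y)) (dec⇒maybe (≡-dec ℕ._≟_ ℕ._≟_ x y))

  open RingSolver coefficients (fromCommutativeRing R) morphism _≟ᶜ_ public
    using (Polynomial; solve; con; _:=_; _:+_; _:*_; _:-_; :-_)

  :0 :1 : ∀ {n} → Polynomial n
  :0 = con (0 , 0)
  :1 = con (1 , 0)

module FieldProperties {c ℓ₁ ℓ₂} (ℝ : RealNumbers c ℓ₁ ℓ₂) where
  open RealNumbers ℝ
  open RealProperties ℝ
  open DifferenceCoefficients commutativeRing hiding (ι) public
  open Mult semiring using (×-homo-+) public
  open SemiringSum semiring using (sum-cong-≋; ∑-distrib-+; *-distribˡ-sum) public
  open ≈-Reasoning setoid

  -- Inverses, finite sums and forward differences.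

  inv-unique : ∀ {x y} (x#0 : x # 0#) → x * y ≈ 1# → inv x#0 ≈ y
  inv-unique {x} {y} x#0 xy≈1 = begin
    inv x#0              ≈⟨ *-identityʳ _ ⟨
    inv x#0 * 1#         ≈⟨ *-congˡ xy≈1 ⟨
    inv x#0 * (x * y)    ≈⟨ solve 3 (λ i x y → i :* (x :* y) := (x :* i) :* y) refl _ x y ⟩
    (x * inv x#0) * y    ≈⟨ *-congʳ (*-invʳ x#0) ⟩
    1# * y               ≈⟨ *-identityˡ y ⟩
    y                    ∎

  *-cancelˡ-# : ∀ {x y z} → x # 0# → x * y ≈ x * z → y ≈ z
  *-cancelˡ-# {x} {y} {z} x#0 xy≈xz = begin
    y                    ≈⟨ cancel y ⟨
    inv x#0 * (x * y)    ≈⟨ *-congˡ xy≈xz ⟩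
    inv x#0 * (x * z)    ≈⟨ cancel z ⟩
    z                    ∎
    where
    cancel : ∀ w → inv x#0 * (x * w) ≈ w
    cancel w = begin
      inv x#0 * (x * w)  ≈⟨ solve 3 (λ i x w → i :* (x :* w) := (x :* i) :* w) refl _ x w ⟩
      x * inv x#0 * w    ≈⟨ *-congʳ (*-invʳ x#0) ⟩
      1# * w             ≈⟨ *-identityˡ w ⟩
      w                  ∎

  ∑-cong : ∀ n {f g : ℕ → Carrier} → (∀ k → f k ≈ g k) →
           ∑[ i < n ] f (toℕ i) ≈ ∑[ i < n ] g (toℕ i)
  ∑-cong n f≈g = sum-cong-≋ {n} (λ i → f≈g (toℕ i))

  ∑-+ : ∀ n (f g : ℕ → Carrier) →
        ∑[ i < n ] (f (toℕ i) + g (toℕ i)) ≈ ∑[ i < n ] f (toℕ i) + ∑[ i < n ] g (toℕ i)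
  ∑-+ n f g = ∑-distrib-+ {n} (λ i → f (toℕ i)) (λ i → g (toℕ i))

  ∑-*ˡ : ∀ n x (f : ℕ → Carrier) → x * ∑[ i < n ] f (toℕ i) ≈ ∑[ i < n ] (x * f (toℕ i))
  ∑-*ˡ n x f = *-distribˡ-sum {n} x (λ i → f (toℕ i))

  ∑-last : ∀ n (f : ℕ → Carrier) → ∑[ i ≤ n ] f (toℕ i) ≈ ∑[ i < n ] f (toℕ i) + f n
  ∑-last zero    f = +-comm _ _
  ∑-last (suc n) f = begin
    f 0 + ∑[ i ≤ n ] f (suc (toℕ i))                 ≈⟨ +-congˡ (∑-last n (λ k → f (suc k))) ⟩
    f 0 + (∑[ i < n ] f (suc (toℕ i)) + f (suc n))   ≈⟨ +-assoc _ _ _ ⟨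
    f 0 + ∑[ i < n ] f (suc (toℕ i)) + f (suc n)     ∎

  ∑-last-0 : ∀ n (f : ℕ → Carrier) → f n ≈ 0# → ∑[ i ≤ n ] f (toℕ i) ≈ ∑[ i < n ] f (toℕ i)
  ∑-last-0 n f fn≈0 = trans (∑-last n f) (trans (+-congˡ fn≈0) (+-identityʳ _))

  ∑-zero : ∀ n (f : ℕ → Carrier) → (∀ k → f k ≈ 0#) → ∑[ i < n ] f (toℕ i) ≈ 0#
  ∑-zero zero    f f≈0 = refl
  ∑-zero (suc n) f f≈0 =
    trans (+-cong (f≈0 0) (∑-zero n (λ k → f (suc k)) (λ k → f≈0 (suc k)))) (+-identityˡ 0#)

  ∑-only : ∀ {n m} → m ≤ n → (f : ℕ → Carrier) → (∀ k → k ≢ m → f k ≈ 0#) →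
           ∑[ i ≤ n ] f (toℕ i) ≈ f m
  ∑-only {n} z≤n f f≈0 =
    trans (+-congˡ (∑-zero n (λ k → f (suc k)) (λ k → f≈0 (suc k) λ ()))) (+-identityʳ _)
  ∑-only (s≤s m≤n) f f≈0 = trans
    (+-cong (f≈0 0 λ ()) (∑-only m≤n (λ k → f (suc k)) (λ k k≢m → f≈0 (suc k) (λ e → k≢m (ℕ.suc-injective e)))))
    (+-identityˡ _)

  -- The n-th forward difference of `g` at 0, in the alternating binomial form in which `η` is
  -- given.
  Δ^ : ℕ → (ℕ → Carrier) → Carrier
  Δ^ n g = ∑[ i ≤ n ] ((- 1#) ^ (n ∸ toℕ i) * ι (n C toℕ i) * g (toℕ i))

  Δ^-zero : ∀ g → Δ^ 0 g ≈ g 0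
  Δ^-zero g = solve 1 (λ x → :1 :* (:1 :+ :0) :* x :+ :0 := x) refl (g 0)

  ι-nCk≈0 : ∀ {n k} → n ℕ.< k → ι (n C k) ≈ 0#
  ι-nCk≈0 n<k = reflexive (≡.cong ι (k>n⇒nCk≡0 n<k))

  -- For k < n the exponent drops by exactly one. Otherwise the truncated subtraction no longer
  -- changes the sign, but then the binomial coefficient is 0.
  sign-shift : ∀ n k → (- 1#) ^ (n ∸ k) * ι (n C suc k) ≈ - ((- 1#) ^ (n ∸ suc k) * ι (n C suc k))
  sign-shift n k with k ℕ.<? n
  ... | yes k<n = begin
    (- 1#) ^ (n ∸ k) * b                  ≡⟨ ≡.cong (λ j → (- 1#) ^ j * b) (ℕ.+-∸-assoc 1 k<n) ⟩
    - 1# * (- 1#) ^ (n ∸ suc k) * b       ≈⟨ solve 2 (λ x b → :- :1 :* x :* b := :- (x :* b)) refl _ b ⟩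
    - ((- 1#) ^ (n ∸ suc k) * b)          ∎
    where b = ι (n C suc k)
  ... | no k≮n = begin
    (- 1#) ^ (n ∸ k) * b                  ≈⟨ *-congˡ b≈0 ⟩
    (- 1#) ^ (n ∸ k) * 0#                 ≈⟨ solve 2 (λ x y → x :* :0 := :- (y :* :0)) refl _ _ ⟩
    - ((- 1#) ^ (n ∸ suc k) * 0#)         ≈⟨ -‿cong (*-congˡ b≈0) ⟨
    - ((- 1#) ^ (n ∸ suc k) * b)          ∎
    where
    b = ι (n C suc k)
    b≈0 = ι-nCk≈0 (s≤s (ℕ.≮⇒≥ k≮n))

  Δ^-suc : ∀ n g → Δ^ (suc n) g ≈ Δ^ n (λ k → g (suc k)) - Δ^ n g
  Δ^-suc n g = begin
    - 1# * (- 1#) ^ n * ι (suc n C 0) * g 0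
      + ∑[ i ≤ n ] ((- 1#) ^ (n ∸ toℕ i) * ι (suc n C suc (toℕ i)) * g (suc (toℕ i)))
                                                    ≈⟨ +-cong head (∑-cong (suc n) pascal) ⟩
    - t 0 + ∑[ i ≤ n ] (u (toℕ i) + - 1# * t (suc (toℕ i)))
                                                    ≈⟨ +-congˡ (trans (∑-+ (suc n) u (λ k → - 1# * t (suc k))) (+-congˡ (sym (∑-*ˡ (suc n) (- 1#) (λ k → t (suc k)))))) ⟩
    - t 0 + (U + - 1# * T)                          ≈⟨ solve 3 (λ t₀ U T → :- t₀ :+ (U :+ :- :1 :* T) := U :- (t₀ :+ T)) refl (t 0) U T ⟩
    -- `t 0 + T` is the sum of `t` up to index n+1, whose last term contains the binomial
    -- coefficient n over n+1, which is 0.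
    U - (t 0 + T)                                   ≈⟨ +-congˡ (-‿cong (∑-last-0 (suc n) t t-last)) ⟩
    Δ^ n (λ k → g (suc k)) - Δ^ n g                 ∎
    where
    t u : ℕ → Carrier
    t k = (- 1#) ^ (n ∸ k) * ι (n C k) * g k
    u k = (- 1#) ^ (n ∸ k) * ι (n C k) * g (suc k)
    U = ∑[ i ≤ n ] u (toℕ i)
    T = ∑[ i ≤ n ] t (suc (toℕ i))
    head : - 1# * (- 1#) ^ n * ι (suc n C 0) * g 0 ≈ - t 0
    head = solve 3 (λ x y z → :- :1 :* x :* y :* z := :- (x :* y :* z)) refl ((- 1#) ^ n) (ι (n C 0)) (g 0)
    t-last : t (suc n) ≈ 0#
    t-last = trans (*-congʳ (trans (*-congˡ (ι-nCk≈0 (ℕ.n<1+n n))) (zeroʳ _))) (zeroˡ _)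
    pascal : ∀ k → (- 1#) ^ (n ∸ k) * ι (suc n C suc k) * g (suc k) ≈ u k + - 1# * t (suc k)
    pascal k = begin
      s * ι (suc n C suc k) * y                          ≡⟨ ≡.cong (λ c → s * ι c * y) (nCk+nC[k+1]≡[n+1]C[k+1] n k) ⟨
      s * ι (n C k ℕ.+ n C suc k) * y                    ≈⟨ *-congʳ (*-congˡ (×-homo-+ 1# (n C k) (n C suc k))) ⟩
      s * (ι (n C k) + ι (n C suc k)) * y                ≈⟨ solve 4 (λ s a b y → s :* (a :+ b) :* y := s :* a :* y :+ s :* b :* y) refl _ _ _ _ ⟩
      u k + s * ι (n C suc k) * y                        ≈⟨ +-congˡ (*-congʳ (sign-shift n k)) ⟩
      u k + - ((- 1#) ^ (n ∸ suc k) * ι (n C suc k)) * y ≈⟨ +-congˡ (solve 2 (λ x y → :- x :* y := :- :1 :* (x :* y)) refl _ y) ⟩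
      u k + - 1# * t (suc k)                             ∎
      where
      s = (- 1#) ^ (n ∸ k)
      y = g (suc k)

module Carlitz {c ℓ₁ ℓ₂} (ℝ : RealNumbers c ℓ₁ ℓ₂)
               (q : RealNumbers.Carrier ℝ)
               (q>0 : RealNumbers._<_ ℝ (RealNumbers.0# ℝ) q)
               (q#1 : RealNumbers._#_ ℝ q (RealNumbers.1# ℝ)) where
  open RealNumbers ℝ
  open RealProperties ℝ
  open FieldProperties ℝ
  open QAnalogues ℝ q q>0 q#1
  open ≈-Reasoning setoid

  -- Powers of q, q-numbers and falling factorials.

  N Q : ℕ → Carrier
  N n = [ ι n ]
  Q n = q^ (ι n)

  Q⁻ : ℕ → Carrier
  Q⁻ n = q^ (- ι n)

  p : Carrier
  p = q - 1#

  q^-cong : ∀ {X Y} → X ≈ Y → q^ X ≈ q^ Y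
  q^-cong = pow-cong q>0 q>0 refl

  q^-inverse : ∀ X → q^ X * q^ (- X) ≈ 1#
  q^-inverse X = begin
    q^ X * q^ (- X)   ≈⟨ pow-+ q>0 X (- X) ⟨
    q^ (X - X)        ≈⟨ q^-cong (-‿inverseʳ X) ⟩
    q^ 0#             ≈⟨ pow-0 q>0 ⟩
    1#                ∎

  q^-0≈1 : q^ (- 0#) ≈ 1#
  q^-0≈1 = trans (q^-cong (solve 0 (:- :0 := :0) refl)) (pow-0 q>0)

  Q-suc : ∀ n → Q (suc n) ≈ q * Q n
  Q-suc n = trans (pow-+ q>0 1# (ι n)) (*-congʳ (pow-1 q>0))

  Q-+ : ∀ m n → Q (m ℕ.+ n) ≈ Q m * Q n
  Q-+ m n = trans (q^-cong (×-homo-+ 1# m n)) (pow-+ q>0 (ι m) (ι n))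

  Q⁻-suc : ∀ n → q * Q⁻ (suc n) ≈ Q⁻ n
  Q⁻-suc n = begin
    q * Q⁻ (suc n)              ≈⟨ *-congʳ (pow-1 q>0) ⟨
    q^ 1# * q^ (- ι (suc n))    ≈⟨ pow-+ q>0 _ _ ⟨
    q^ (1# - (1# + ι n))        ≈⟨ q^-cong (solve 1 (λ x → :1 :- (:1 :+ x) := :- x) refl (ι n)) ⟩
    Q⁻ n                        ∎

  p*[] : ∀ X → p * [ X ] ≈ q^ X - 1#
  p*[] X = begin
    p * ((q^ X - 1#) * inv q-1#0)    ≈⟨ solve 3 (λ p x i → p :* (x :* i) := x :* (p :* i)) refl _ _ _ ⟩
    (q^ X - 1#) * (p * inv q-1#0)    ≈⟨ *-congˡ (*-invʳ q-1#0) ⟩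
    (q^ X - 1#) * 1#                 ≈⟨ *-identityʳ _ ⟩
    q^ X - 1#                        ∎

  []-+ : ∀ X Y → [ X + Y ] ≈ [ X ] + q^ X * [ Y ]
  []-+ X Y = begin
    (q^ (X + Y) - 1#) * i                      ≈⟨ *-congʳ (+-congʳ (pow-+ q>0 X Y)) ⟩
    (q^ X * q^ Y - 1#) * i                     ≈⟨ solve 3 (λ x y i → (x :* y :- :1) :* i := (x :- :1) :* i :+ x :* ((y :- :1) :* i)) refl _ _ i ⟩
    [ X ] + q^ X * [ Y ]                       ∎
    where i = inv q-1#0

  [0]≈0 : ∀ {X} → X ≈ 0# → [ X ] ≈ 0#
  [0]≈0 X≈0 = begin
    (q^ _ - 1#) * inv q-1#0     ≈⟨ *-congʳ (+-congʳ (trans (q^-cong X≈0) (pow-0 q>0))) ⟩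
    (1# - 1#) * inv q-1#0       ≈⟨ solve 1 (λ i → (:1 :- :1) :* i := :0) refl _ ⟩
    0#                          ∎

  N-suc : ∀ n → N (suc n) ≈ 1# + q * N n
  N-suc n = begin
    [ 1# + ι n ]              ≈⟨ []-+ 1# (ι n) ⟩
    [ 1# ] + q^ 1# * N n      ≈⟨ +-cong [1]≈1 (*-congʳ (pow-1 q>0)) ⟩
    1# + q * N n              ∎
    where
    [1]≈1 : [ 1# ] ≈ 1#
    [1]≈1 = trans (*-congʳ (+-congʳ (pow-1 q>0))) (*-invʳ q-1#0)

  ↓-cong : ∀ k {X Y} → X ≈ Y → [ X ]↓ k ≈ [ Y ]↓ k
  ↓-cong zero    X≈Y = refl
  ↓-cong (suc k) X≈Y = *-cong (↓-cong k X≈Y) ([]-cong (+-congʳ X≈Y))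

  ↓-sucˡ : ∀ X k → [ X ]↓ suc k ≈ [ X ] * [ X - 1# ]↓ k
  ↓-sucˡ X zero = begin
    1# * [ X - 0# ]    ≈⟨ *-congˡ ([]-cong (x-0≈x X)) ⟩
    1# * [ X ]         ≈⟨ *-comm _ _ ⟩
    [ X ] * 1#         ∎
  ↓-sucˡ X (suc k) = begin
    [ X ]↓ suc k * [ X - ι (suc k) ]                 ≈⟨ *-cong (↓-sucˡ X k) ([]-cong (solve 2 (λ x k → x :- (:1 :+ k) := (x :- :1) :- k) refl X (ι k))) ⟩
    [ X ] * [ X - 1# ]↓ k * [ X - 1# - ι k ]         ≈⟨ *-assoc _ _ _ ⟩
    [ X ] * [ X - 1# ]↓ suc k                        ∎

  ι-suc-1 : ∀ n → ι (suc n) - 1# ≈ ι n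
  ι-suc-1 n = solve 1 (λ x → (:1 :+ x) :- :1 := x) refl (ι n)

  ↓-suc-suc : ∀ n k → [ ι (suc n) ]↓ suc k ≈ N (suc n) * [ ι n ]↓ k
  ↓-suc-suc n k = trans (↓-sucˡ (ι (suc n)) k) (*-congˡ (↓-cong k (ι-suc-1 n)))

  ↓-vanish : ∀ {m k} → m ℕ.< k → [ ι m ]↓ k ≈ 0#
  ↓-vanish {m} {suc k} (s≤s m≤k) with m ℕ.≟ k
  ... | yes ≡.refl = trans (*-congˡ ([0]≈0 (-‿inverseʳ (ι m)))) (zeroʳ _)
  ... | no m≢k     = trans (*-congʳ (↓-vanish (ℕ.≤∧≢⇒< m≤k m≢k))) (zeroˡ _)

  -- The q-Stirling numbers and the falling factorial basis.

  triangle-suc : ∀ k → (suc k ℕ.* suc (suc k)) div 2 ≡ (k ℕ.* suc k) div 2 ℕ.+ suc k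
  triangle-suc k = ≡.trans (≡.cong (_div 2) (expand k))
    (≡.trans (+-distrib-/-∣ʳ (k ℕ.* suc k) (n∣m*n (suc k)))
      (≡.cong ((k ℕ.* suc k) div 2 ℕ.+_) (m*n/n≡m (suc k) 2)))
    where
    expand : ∀ k → suc k ℕ.* suc (suc k) ≡ k ℕ.* suc k ℕ.+ suc k ℕ.* 2
    expand = solve-∀

  triangle-pred : ∀ k → (suc k ℕ.* k) div 2 ≡ (k ℕ.* (k ∸ 1)) div 2 ℕ.+ k
  triangle-pred zero    = ≡.refl
  triangle-pred (suc k) = ≡.trans (≡.cong (_div 2) (ℕ.*-comm (suc (suc k)) (suc k)))
    (≡.trans (triangle-suc k) (≡.cong (λ j → j div 2 ℕ.+ suc k) (ℕ.*-comm k (suc k))))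

  -- A model defined by the recurrence and equal to 0 above the diagonal, where `IsqStirling₂`
  -- leaves its argument free. The shifted sums below rely on these zeros.
  S₂ : ℕ → ℕ → Carrier
  S₂ zero    zero    = 1#
  S₂ zero    (suc k) = 0#
  S₂ (suc n) zero    = 0#
  S₂ (suc n) (suc k) = S₂ n k + N (suc k) * S₂ n (suc k)

  S₂-vanish : ∀ {n k} → n ℕ.< k → S₂ n k ≈ 0#
  S₂-vanish {zero}  {suc k} _         = refl
  S₂-vanish {suc n} {suc k} (s≤s n<k) =
    trans (+-cong (S₂-vanish n<k) (trans (*-congˡ (S₂-vanish (ℕ.m≤n⇒m≤1+n n<k))) (zeroʳ _))) (+-identityˡ 0#)

  ∑S₂-zero : ∀ (e : ℕ → Carrier) → ∑[ i ≤ 0 ] (S₂ 0 (toℕ i) * e (toℕ i)) ≈ e 0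
  ∑S₂-zero e = trans (+-identityʳ _) (*-identityˡ (e 0))

  -- Summation by parts: the recurrence moves from `S₂` to the weights. It serves twice, with
  -- `basis X` for the expansion of [X]ⁿ and with the weights `φ` for the expansion of β.
  ∑S₂-suc : ∀ n (e : ℕ → Carrier) →
            ∑[ i ≤ suc n ] (S₂ (suc n) (toℕ i) * e (toℕ i)) ≈
            ∑[ i ≤ n ] (S₂ n (toℕ i) * (e (suc (toℕ i)) + N (toℕ i) * e (toℕ i)))
  ∑S₂-suc n e = begin
    0# * e 0 + ∑[ i ≤ n ] ((S₂ n (toℕ i) + N (suc (toℕ i)) * S₂ n (suc (toℕ i))) * e (suc (toℕ i)))
      ≈⟨ +-cong (trans (zeroˡ (e 0)) (sym h₀)) (trans (∑-cong (suc n) λ k →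
           solve 4 (λ a b c d → (a :+ b :* c) :* d := a :* d :+ c :* (b :* d)) refl (S₂ n k) (N (suc k)) (S₂ n (suc k)) (e (suc k))) (∑-+ (suc n) g (λ k → h (suc k)))) ⟩
    h 0 + (G + H)             ≈⟨ solve 3 (λ x y z → x :+ (y :+ z) := y :+ (x :+ z)) refl (h 0) G H ⟩
    -- `h 0 + H` is the sum of `h` over all indices up to n+1. The term `h 0` could be inserted
    -- because [0] = 0, and the last one drops because `S₂ n (suc n)` vanishes.
    G + (h 0 + H)             ≈⟨ +-congˡ (∑-last-0 (suc n) h (trans (*-congʳ (S₂-vanish (ℕ.n<1+n n))) (zeroˡ _))) ⟩
    G + ∑[ i ≤ n ] h (toℕ i)  ≈⟨ ∑-+ (suc n) g h ⟨
    ∑[ i ≤ n ] (g (toℕ i) + h (toℕ i))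
      ≈⟨ ∑-cong (suc n) (λ k → sym (distribˡ (S₂ n k) (e (suc k)) (N k * e k))) ⟩
    ∑[ i ≤ n ] (S₂ n (toℕ i) * (e (suc (toℕ i)) + N (toℕ i) * e (toℕ i)))  ∎
    where
    g h : ℕ → Carrier
    g k = S₂ n k * e (suc k)
    h k = S₂ n k * (N k * e k)
    G = ∑[ i ≤ n ] g (toℕ i)
    H = ∑[ i ≤ n ] h (suc (toℕ i))
    h₀ : h 0 ≈ 0#
    h₀ = trans (*-congˡ (trans (*-congʳ ([0]≈0 refl)) (zeroˡ _))) (zeroʳ _)

  basis : Carrier → ℕ → Carrier
  basis X k = Q ((k ℕ.* (k ∸ 1)) div 2) * [ X ]↓ k

  -- Splitting X as k + (X - k) gives [X] = [k] + qᵏ [X-k]. The factor [X-k] extends the falling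
  -- factorial, and qᵏ raises the exponent from k(k-1)/2 to (k+1)k/2.
  []*basis : ∀ X k → [ X ] * basis X k ≈ basis X (suc k) + N k * basis X k
  []*basis X k = begin
    [ X ] * (t * f)                          ≈⟨ *-congʳ ([]-cong (solve 2 (λ x k → x := k :+ (x :- k)) refl X (ι k))) ⟩
    [ ι k + (X - ι k) ] * (t * f)            ≈⟨ *-congʳ ([]-+ (ι k) (X - ι k)) ⟩
    (N k + Q k * [ X - ι k ]) * (t * f)      ≈⟨ solve 5 (λ a b c d e → (a :+ b :* c) :* (d :* e) := (d :* b) :* (e :* c) :+ a :* (d :* e)) refl _ _ _ _ _ ⟩
    t * Q k * (f * [ X - ι k ]) + N k * (t * f)
      ≈⟨ +-congʳ (*-congʳ (trans (sym (Q-+ ((k ℕ.* (k ∸ 1)) div 2) k)) (reflexive (≡.cong Q (≡.sym (triangle-pred k)))))) ⟩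
    basis X (suc k) + N k * basis X k        ∎
    where
    t = Q ((k ℕ.* (k ∸ 1)) div 2)
    f = [ X ]↓ k

  S₂-expansion : ∀ n X → [ X ] ^ n ≈ ∑[ i ≤ n ] (S₂ n (toℕ i) * basis X (toℕ i))
  S₂-expansion zero    X = begin
    1#                       ≈⟨ solve 0 (:1 := :1 :* (:1 :* :1) :+ :0) refl ⟩
    1# * (1# * 1#) + 0#      ≈⟨ +-congʳ (*-congˡ (*-congʳ (pow-0 q>0))) ⟨
    1# * basis X 0 + 0#      ∎
  S₂-expansion (suc n) X = begin
    [ X ] * [ X ] ^ n                                                ≈⟨ *-congˡ (S₂-expansion n X) ⟩
    [ X ] * ∑[ i ≤ n ] (S₂ n (toℕ i) * basis X (toℕ i))              ≈⟨ ∑-*ˡ (suc n) [ X ] (λ k → S₂ n k * basis X k) ⟩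
    ∑[ i ≤ n ] ([ X ] * (S₂ n (toℕ i) * basis X (toℕ i)))            ≈⟨ ∑-cong (suc n) (λ k → trans
                                                                         (solve 3 (λ x s b → x :* (s :* b) := s :* (x :* b)) refl [ X ] (S₂ n k) (basis X k))
                                                                         (*-congˡ ([]*basis X k))) ⟩
    ∑[ i ≤ n ] (S₂ n (toℕ i) * (basis X (suc (toℕ i)) + N (toℕ i) * basis X (toℕ i)))
                                                                     ≈⟨ ∑S₂-suc n (basis X) ⟨
    ∑[ i ≤ suc n ] (S₂ (suc n) (toℕ i) * basis X (toℕ i))            ∎

  basis#0 : ∀ m → basis (ι m) m # 0#
  basis#0 m = x#0y#0→xy#0 (q^#0 _) ([n]!#0 m)
    where
    q^#0 : ∀ X → q^ X # 0#
    q^#0 X = invertibleʳ⇒# (q^ (- X) , trans (*-congʳ (x-0≈x _)) (q^-inverse X))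

  basis-vanish : ∀ {m k} → m ℕ.< k → basis (ι m) k ≈ 0#
  basis-vanish m<k = trans (*-congˡ (↓-vanish m<k)) (zeroʳ _)

  -- Evaluating at X = 0, 1, …, n gives a triangular system for the coefficients.
  basis-independent : ∀ n (d : ℕ → Carrier) → (∀ X → ∑[ i ≤ n ] (d (toℕ i) * basis X (toℕ i)) ≈ 0#) →
                      ∀ k → k ≤ n → d k ≈ 0#
  basis-independent n d ∑≈0 = <-rec _ λ m rec m≤n → *-cancelˡ-# (basis#0 m) (begin
    basis (ι m) m * d m                               ≈⟨ *-comm _ _ ⟩
    d m * basis (ι m) m                               ≈⟨ ∑-only m≤n (λ k → d k * basis (ι m) k) (λ k k≢m → others m m≤n rec k k≢m) ⟨
    ∑[ i ≤ n ] (d (toℕ i) * basis (ι m) (toℕ i))      ≈⟨ ∑≈0 (ι m) ⟩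
    0#                                                ≈⟨ zeroʳ _ ⟨
    basis (ι m) m * 0#                                ∎)
    where
    others : ∀ m → m ≤ n → (∀ {k} → k ℕ.< m → k ≤ n → d k ≈ 0#) → ∀ k → k ≢ m → d k * basis (ι m) k ≈ 0#
    others m m≤n rec k k≢m with ℕ.<-cmp k m
    ... | tri< k<m _ _ = trans (*-congʳ (rec k<m (ℕ.≤-trans (ℕ.<⇒≤ k<m) m≤n))) (zeroˡ _)
    ... | tri≈ _ k≡m _ = contradiction k≡m k≢m
    ... | tri> _ _ m<k = trans (*-congˡ (basis-vanish m<k)) (zeroʳ _)

  qStirling₂-unique : ∀ {S} → IsqStirling₂ S → ∀ n k → k ≤ n → S n k ≈ S₂ n k
  qStirling₂-unique {S} isS n k k≤n = begin
    S n k                         ≈⟨ solve 2 (λ x y → x := (x :+ :- :1 :* y) :+ y) refl _ _ ⟩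
    (S n k + - 1# * S₂ n k) + S₂ n k    ≈⟨ +-congʳ (basis-independent n (λ k → S n k + - 1# * S₂ n k) diff k k≤n) ⟩
    0# + S₂ n k                   ≈⟨ +-identityˡ _ ⟩
    S₂ n k                        ∎
    where
    diff : ∀ X → ∑[ i ≤ n ] ((S n (toℕ i) + - 1# * S₂ n (toℕ i)) * basis X (toℕ i)) ≈ 0#
    diff X = begin
      ∑[ i ≤ n ] ((S n (toℕ i) + - 1# * S₂ n (toℕ i)) * basis X (toℕ i))
        ≈⟨ ∑-cong (suc n) (λ k → solve 4 (λ s s′ t f → (s :+ :- :1 :* s′) :* (t :* f) := t :* s :* f :+ :- :1 :* (s′ :* (t :* f)))
             refl (S n k) (S₂ n k) (Q ((k ℕ.* (k ∸ 1)) div 2)) ([ X ]↓ k)) ⟩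
      ∑[ i ≤ n ] (a (toℕ i) + - 1# * b (toℕ i))
        ≈⟨ trans (∑-+ (suc n) a (λ k → - 1# * b k)) (+-congˡ (sym (∑-*ˡ (suc n) (- 1#) b))) ⟩
      ∑[ i ≤ n ] a (toℕ i) + - 1# * ∑[ i ≤ n ] b (toℕ i)
        ≈⟨ +-cong (isS n X) (*-congˡ (S₂-expansion n X)) ⟨
      [ X ] ^ n + - 1# * [ X ] ^ n      ≈⟨ solve 1 (λ x → x :+ :- :1 :* x := :0) refl _ ⟩
      0#                                ∎
      where
      a b : ℕ → Carrier
      a k = Q ((k ℕ.* (k ∸ 1)) div 2) * S n k * [ X ]↓ k
      b k = S₂ n k * basis X k

  -- The polynomials β at X = 0.

  β-step : ∀ r n → β r (suc n) 0# ≈ inv q-1#0 * (β (suc r) n 0# - β r n 0#)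
  β-step r n = begin
    b′                                               ≈⟨ *-identityˡ b′ ⟨
    1# * b′                                          ≈⟨ *-congʳ (*-invʳ q-1#0) ⟨
    (p * i) * b′                                     ≈⟨ solve 4 (λ p i b b′ → p :* i :* b′ := i :* (:1 :* (b :+ p :* b′) :- b)) refl p i b b′ ⟩
    i * (1# * (b + p * b′) - b)                      ≈⟨ *-congˡ (+-congʳ (*-congʳ q^-0≈1)) ⟨
    i * (q^ (- 0#) * (b + p * b′) - b)               ∎
    where
    i = inv q-1#0
    b = β r n 0#
    b′ = β r (suc n) 0#

  -- At X = 0, raising r adds the (n+1)-st difference to the n-th, the powers of q-1 cancelling.
  -- Since the (n+1)-st difference is the n-th difference of the shifted sequence minus that of the
  -- original, the net effect is to shift the sequence by one. The case n = 0 yields β₀⁽ʳ⁾.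
  β-Δ : ∀ r n → β r n 0# ≈ inv q-1#0 ^ n * Δ^ n (λ k → k/[k] (r ℕ.+ k))
  β-Δ zero n = *-congˡ (∑-cong (suc n)
    {λ k → (- 1#) ^ (n ∸ k) * ι (n C k) * k/[k] k * q^ (ι k * 0#)}
    {λ k → (- 1#) ^ (n ∸ k) * ι (n C k) * k/[k] k}
    λ k → trans (*-congˡ (trans (q^-cong (zeroʳ (ι k))) (pow-0 q>0))) (*-identityʳ _))
  β-Δ (suc r) n = begin
    q^ (- 0#) * (β r n 0# + p * β r (suc n) 0#)      ≈⟨ *-cong q^-0≈1 (+-cong (β-Δ r n) (*-congˡ (trans (β-Δ r (suc n)) (*-congˡ (Δ^-suc n g))))) ⟩
    1# * (i ^ n * d + p * (i * i ^ n * (d′ - d)))    ≈⟨ solve 5 (λ p i x d d′ → :1 :* (x :* d :+ p :* (i :* x :* (d′ :- d))) := x :* d :+ (p :* i) :* (x :* (d′ :- d))) refl p i (i ^ n) d d′ ⟩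
    i ^ n * d + (p * i) * (i ^ n * (d′ - d))         ≈⟨ +-congˡ (*-congʳ (*-invʳ q-1#0)) ⟩
    i ^ n * d + 1# * (i ^ n * (d′ - d))              ≈⟨ solve 3 (λ x d d′ → x :* d :+ :1 :* (x :* (d′ :- d)) := x :* d′) refl (i ^ n) d d′ ⟩
    i ^ n * d′                                       ≈⟨ *-congˡ (∑-cong (suc n) λ k →
                                                          *-congˡ {(- 1#) ^ (n ∸ k) * ι (n C k)} (reflexive (≡.cong k/[k] (ℕ.+-suc r k)))) ⟩
    i ^ n * Δ^ n (λ k → k/[k] (suc r ℕ.+ k))         ∎
    where
    i = inv q-1#0
    g : ℕ → Carrier
    g k = k/[k] (r ℕ.+ k)
    d = Δ^ n g
    d′ = Δ^ n (λ k → g (suc k))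

  -- The first expression for φ.

  σ : ℕ → Carrier
  σ k = (- 1#) ^ k * [ k ]!

  p*σ : ∀ k → p * σ (suc k) ≈ (1# - Q (suc k)) * σ k
  p*σ k = begin
    p * (- 1# * (- 1#) ^ k * [ suc k ]!)                ≈⟨ *-congˡ (*-congˡ (↓-suc-suc k k)) ⟩
    p * (- 1# * (- 1#) ^ k * (N (suc k) * [ k ]!))      ≈⟨ solve 4 (λ p s n f → p :* (:- :1 :* s :* (n :* f)) := :- (p :* n) :* (s :* f)) refl p ((- 1#) ^ k) (N (suc k)) [ k ]! ⟩
    - (p * N (suc k)) * σ k                             ≈⟨ *-congʳ (-‿cong (p*[] (ι (suc k)))) ⟩
    - (Q (suc k) - 1#) * σ k                            ≈⟨ *-congʳ (solve 1 (λ x → :- (x :- :1) := :1 :- x) refl (Q (suc k))) ⟩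
    (1# - Q (suc k)) * σ k                              ∎

  -- The same proof term as in the definition of `φ`, so that `φ r k` is `σ k * Φ r k` by definition
  -- and no two inverses have to be compared.
  ↓#0 : ∀ r k (i : Fin r) → [ ι (k ℕ.+ r) ]↓ suc (toℕ i) # 0#
  ↓#0 r k i = [n]↓m#0 (ℕ.≤-trans (toℕ<n i) (ℕ.m≤n+m r k))

  Φ : ℕ → ℕ → Carrier
  Φ r k = ∑[ i < r ] (Q (toℕ i ℕ.* k) * [ ι r - 1# ]↓ toℕ i * inv (↓#0 r k i))

  -- The term i = 0 contributes the 1. In every later term [k+r+1] cancels the leading factor of
  -- [k+r+1]ᵢ₊₂, while [r]ᵢ₊₁ = [r][r-1]ᵢ and one power qᵏ come out, leaving a term of `Φ r k`.
  Φ-suc : ∀ r k → N (suc (k ℕ.+ r)) * Φ (suc r) k ≈ 1# + Q k * N r * Φ r k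
  Φ-suc r k = begin
    M * (first + rest)                    ≈⟨ distribˡ M first rest ⟩
    M * first + M * rest                  ≈⟨ +-cong M*first (*-distribˡ-sum {r} M _) ⟩
    1# + ∑[ i < r ] (M * (Q (k ℕ.+ toℕ i ℕ.* k) * [ ι (suc r) - 1# ]↓ suc (toℕ i) * inv (↓#0 (suc r) k (suc i))))
                                          ≈⟨ +-congˡ (sum-cong-≋ {r} M*rest) ⟩
    1# + ∑[ i < r ] (Q k * N r * (Q (toℕ i ℕ.* k) * [ ι r - 1# ]↓ toℕ i * inv (↓#0 r k i)))
                                          ≈⟨ +-congˡ (*-distribˡ-sum {r} (Q k * N r) _) ⟨
    1# + Q k * N r * Φ r k                ∎
    where
    M = N (suc (k ℕ.+ r))
    first = Q 0 * 1# * inv (↓#0 (suc r) k Fin.zero)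
    rest = ∑[ i < r ] (Q (k ℕ.+ toℕ i ℕ.* k) * [ ι (suc r) - 1# ]↓ suc (toℕ i) * inv (↓#0 (suc r) k (suc i)))

    peel : ∀ j → [ ι (k ℕ.+ suc r) ]↓ suc j ≈ M * [ ι (k ℕ.+ r) ]↓ j
    peel j = trans (reflexive (≡.cong (λ n → [ ι n ]↓ suc j) (ℕ.+-suc k r))) (↓-suc-suc (k ℕ.+ r) j)

    M*first : M * first ≈ 1#
    M*first = begin
      M * (Q 0 * 1# * x)           ≈⟨ *-congˡ (*-congʳ (*-congʳ (pow-0 q>0))) ⟩
      M * (1# * 1# * x)            ≈⟨ solve 2 (λ m x → m :* (:1 :* :1 :* x) := (m :* :1) :* x) refl M x ⟩
      (M * 1#) * x                 ≈⟨ *-congʳ (peel 0) ⟨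
      [ ι (k ℕ.+ suc r) ]↓ 1 * x   ≈⟨ *-invʳ (↓#0 (suc r) k Fin.zero) ⟩
      1#                           ∎
      where x = inv (↓#0 (suc r) k Fin.zero)

    M*rest : ∀ i → M * (Q (k ℕ.+ toℕ i ℕ.* k) * [ ι (suc r) - 1# ]↓ suc (toℕ i) * inv (↓#0 (suc r) k (suc i)))
                 ≈ Q k * N r * (Q (toℕ i ℕ.* k) * [ ι r - 1# ]↓ toℕ i * inv (↓#0 r k i))
    M*rest i = begin
      M * (Q (k ℕ.+ j ℕ.* k) * [ ι (suc r) - 1# ]↓ suc j * x)
        ≈⟨ *-congˡ (*-congʳ (*-cong (Q-+ k (j ℕ.* k)) (trans (↓-cong (suc j) (ι-suc-1 r)) (↓-sucˡ (ι r) j)))) ⟩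
      M * (Q k * Q (j ℕ.* k) * (N r * [ ι r - 1# ]↓ j) * x)
        ≈⟨ solve 6 (λ m a b n f x → m :* (a :* b :* (n :* f) :* x) := a :* n :* (b :* f :* (m :* x))) refl M (Q k) (Q (j ℕ.* k)) (N r) ([ ι r - 1# ]↓ j) x ⟩
      Q k * N r * (Q (j ℕ.* k) * [ ι r - 1# ]↓ j * (M * x))
        -- The two inverses come from different apartness proofs, so they are related through
        -- uniqueness: `M * x` also inverts [k+r]ᵢ₊₁.
        ≈⟨ *-congˡ (*-congˡ (inv-unique (↓#0 r k i) unit)) ⟨
      Q k * N r * (Q (j ℕ.* k) * [ ι r - 1# ]↓ j * inv (↓#0 r k i))    ∎
      where
      j = toℕ i
      x = inv (↓#0 (suc r) k (suc i))
      y = [ ι (k ℕ.+ r) ]↓ suc j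
      unit : y * (M * x) ≈ 1#
      unit = begin
        y * (M * x)                                  ≈⟨ solve 3 (λ y m x → y :* (m :* x) := (m :* y) :* x) refl y M x ⟩
        (M * y) * x                                  ≈⟨ *-congʳ (peel (suc j)) ⟨
        [ ι (k ℕ.+ suc r) ]↓ suc (suc j) * x         ≈⟨ *-invʳ (↓#0 (suc r) k (suc i)) ⟩
        1#                                           ∎

  -- At k = 0 the relation `Φ-suc` says that [r] Φᵣ(0) grows by 1 with each r.
  N*Φ-zero : ∀ r → N r * Φ r 0 ≈ ι r
  N*Φ-zero zero    = zeroʳ (N 0)
  N*Φ-zero (suc r) = begin
    N (suc r) * Φ (suc r) 0          ≈⟨ Φ-suc r 0 ⟩
    1# + Q 0 * N r * Φ r 0           ≈⟨ +-congˡ (trans (*-assoc (Q 0) (N r) (Φ r 0)) (*-cong (pow-0 q>0) (N*Φ-zero r))) ⟩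
    1# + 1# * ι r                    ≈⟨ +-congˡ (*-identityˡ (ι r)) ⟩
    1# + ι r                         ∎

  mutual
    Φ-cross : ∀ r k → Φ (suc (suc r)) k ≈ (1# - Q (suc k)) * Φ (suc r) (suc k) + Q k * Φ (suc r) k
    Φ-cross r k = *-cancelˡ-# ([1+n]#0 (suc (k ℕ.+ r))) (begin
      M * Φ (suc (suc r)) k                                    ≈⟨ *-congʳ (reflexive (≡.cong (λ j → N (suc j)) (ℕ.+-suc k r))) ⟨
      N (suc (k ℕ.+ suc r)) * Φ (suc (suc r)) k                ≈⟨ Φ-suc (suc r) k ⟩
      1# + u * N (suc r) * A                                   ≈⟨ +-congˡ (*-congʳ (*-congˡ (N-suc r))) ⟩
      1# + u * (1# + q * n) * A                                ≈⟨ solve 4 (λ u q n A → :1 :+ u :* (:1 :+ q :* n) :* A := :1 :+ u :* A :+ q :* u :* (n :* A)) refl u q n A ⟩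
      1# + u * A + q * u * (n * A)                             ≈⟨ +-congˡ (*-cong (sym (Q-suc k)) (N*Φ-cross r k)) ⟩
      -- Writing the constant 1 as (1 - u′) + u′ gives each of the two brackets its own 1, which
      -- makes them the right-hand sides of `Φ-suc` at k+1 and at k.
      1# + u * A + u′ * (n * ((1# - u′) * E + u * F))          ≈⟨ solve 6 (λ u u′ n A E F →
                                                                    :1 :+ u :* A :+ u′ :* (n :* ((:1 :- u′) :* E :+ u :* F)) :=
                                                                    (:1 :- u′) :* (:1 :+ u′ :* n :* E) :+ u :* A :+ u′ :* (:1 :+ u :* n :* F)) refl u u′ n A E F ⟩
      (1# - u′) * (1# + u′ * n * E) + u * A + u′ * (1# + u * n * F)
                                                               ≈⟨ +-cong (+-congʳ (*-congˡ (Φ-suc r (suc k)))) (*-cong (sym (Q-suc k)) (Φ-suc r k)) ⟨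
      (1# - u′) * (M * B) + u * A + q * u * (m * A)            ≈⟨ solve 7 (λ u u′ q m M A B → (:1 :- u′) :* (M :* B) :+ u :* A :+ q :* u :* (m :* A) :=
                                                                    (:1 :- u′) :* (M :* B) :+ (:1 :+ q :* m) :* (u :* A)) refl u u′ q m M A B ⟩
      (1# - u′) * (M * B) + (1# + q * m) * (u * A)             ≈⟨ +-congˡ (*-congʳ (N-suc (suc (k ℕ.+ r)))) ⟨
      (1# - u′) * (M * B) + M * (u * A)                        ≈⟨ solve 5 (λ u u′ M A B → (:1 :- u′) :* (M :* B) :+ M :* (u :* A) :=
                                                                    M :* ((:1 :- u′) :* B :+ u :* A)) refl u u′ M A B ⟩
      M * ((1# - u′) * B + u * A)                              ∎)
      where
      M = N (suc (suc (k ℕ.+ r)))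
      m = N (suc (k ℕ.+ r))
      n = N r
      u = Q k
      u′ = Q (suc k)
      A = Φ (suc r) k
      B = Φ (suc r) (suc k)
      E = Φ r (suc k)
      F = Φ r k

    -- The form of the induction hypothesis that survives r = 0: both sides are then multiples of
    -- [0] = 0, although the relation without that factor fails there.
    N*Φ-cross : ∀ r k → N r * Φ (suc r) k ≈ N r * ((1# - Q (suc k)) * Φ r (suc k) + Q k * Φ r k)
    N*Φ-cross zero    k = trans (N0* _) (sym (N0* _))
      where
      N0* : ∀ x → N 0 * x ≈ 0#
      N0* x = trans (*-congʳ ([0]≈0 refl)) (zeroˡ x)
    N*Φ-cross (suc r) k = *-congˡ (Φ-cross r k)

  φ-suc : ∀ r k → φ (suc (suc r)) k ≈ p * φ (suc r) (suc k) + Q k * φ (suc r) k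
  φ-suc r k = begin
    σ k * Φ (suc (suc r)) k                                    ≈⟨ *-congˡ (Φ-cross r k) ⟩
    σ k * ((1# - Q (suc k)) * B + Q k * A)                     ≈⟨ solve 5 (λ s x u A B → s :* (x :* B :+ u :* A) := x :* s :* B :+ u :* (s :* A)) refl (σ k) (1# - Q (suc k)) (Q k) A B ⟩
    (1# - Q (suc k)) * σ k * B + Q k * (σ k * A)               ≈⟨ +-congʳ (*-congʳ (p*σ k)) ⟨
    p * σ (suc k) * B + Q k * (σ k * A)                        ≈⟨ +-congʳ (*-assoc p (σ (suc k)) B) ⟩
    p * (σ (suc k) * B) + Q k * (σ k * A)                      ∎
    where
    A = Φ (suc r) k
    B = Φ (suc r) (suc k)

  φ-zero : ∀ r → k/[k] (suc r) ≈ φ (suc r) 0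
  φ-zero r = begin
    ι (suc r) * x                    ≈⟨ *-congʳ (N*Φ-zero (suc r)) ⟨
    N (suc r) * F * x                ≈⟨ solve 3 (λ n f x → n :* f :* x := n :* x :* f) refl (N (suc r)) F x ⟩
    N (suc r) * x * F                ≈⟨ *-congʳ (*-invʳ ([1+n]#0 r)) ⟩
    1# * F                           ≈⟨ *-congʳ (*-identityˡ 1#) ⟨
    σ 0 * F                          ∎
    where
    x = inv ([1+n]#0 r)
    F = Φ (suc r) 0

  -- Expansion of β over the Stirling numbers.

  ∑S₂-difference : ∀ n {f g : ℕ → Carrier} → (∀ k → f k ≈ p * g (suc k) + Q k * g k) →
    inv q-1#0 * (∑[ i ≤ n ] (S₂ n (toℕ i) * f (toℕ i)) - ∑[ i ≤ n ] (S₂ n (toℕ i) * g (toℕ i))) ≈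
    ∑[ i ≤ suc n ] (S₂ (suc n) (toℕ i) * g (toℕ i))
  ∑S₂-difference n {f} {g} f≈ = begin
    i * (∑[ k ≤ n ] sf (toℕ k) - ∑[ k ≤ n ] sg (toℕ k))          ≈⟨ solve 3 (λ i x y → i :* (x :- y) := i :* x :+ :- i :* y) refl i (∑[ k ≤ n ] sf (toℕ k)) (∑[ k ≤ n ] sg (toℕ k)) ⟩
    i * ∑[ k ≤ n ] sf (toℕ k) + - i * ∑[ k ≤ n ] sg (toℕ k)      ≈⟨ +-cong (∑-*ˡ (suc n) i sf) (∑-*ˡ (suc n) (- i) sg) ⟩
    ∑[ k ≤ n ] (i * sf (toℕ k)) + ∑[ k ≤ n ] (- i * sg (toℕ k))  ≈⟨ ∑-+ (suc n) (λ k → i * sf k) (λ k → - i * sg k) ⟨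
    ∑[ k ≤ n ] (i * sf (toℕ k) + - i * sg (toℕ k))               ≈⟨ ∑-cong (suc n) difference ⟩
    ∑[ k ≤ n ] (S₂ n (toℕ k) * (g (suc (toℕ k)) + N (toℕ k) * g (toℕ k)))
                                                                 ≈⟨ ∑S₂-suc n g ⟨
    ∑[ k ≤ suc n ] (S₂ (suc n) (toℕ k) * g (toℕ k))              ∎
    where
    i = inv q-1#0
    sf sg : ℕ → Carrier
    sf k = S₂ n k * f k
    sg k = S₂ n k * g k
    difference : ∀ k → i * sf k + - i * sg k ≈ S₂ n k * (g (suc k) + N k * g k)
    difference k = begin
      i * (s * f k) + - i * (s * b)                    ≈⟨ +-congʳ (*-congˡ (*-congˡ (f≈ k))) ⟩
      i * (s * (p * a + Q k * b)) + - i * (s * b)      ≈⟨ solve 6 (λ i s p a u b → i :* (s :* (p :* a :+ u :* b)) :+ :- i :* (s :* b) := s :* (p :* i :* a :+ i :* (u :- :1) :* b)) refl i s p a (Q k) b ⟩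
      -- Here p i = 1, and i (qᵏ - 1) is [k] by definition, so the weights become those of
      -- `∑S₂-suc`.
      s * (p * i * a + i * (Q k - 1#) * b)             ≈⟨ *-congˡ (+-cong (trans (*-congʳ (*-invʳ q-1#0)) (*-identityˡ a)) (*-congʳ (*-comm i (Q k - 1#)))) ⟩
      s * (a + N k * b)                                ∎
      where
      s = S₂ n k
      a = g (suc k)
      b = g k

  β-zero : ∀ r → β r 0 0# ≈ k/[k] r
  β-zero r = begin
    β r 0 0#                           ≈⟨ β-Δ r 0 ⟩
    1# * Δ^ 0 (λ k → k/[k] (r ℕ.+ k))  ≈⟨ *-identityˡ _ ⟩
    Δ^ 0 (λ k → k/[k] (r ℕ.+ k))       ≈⟨ Δ^-zero (λ k → k/[k] (r ℕ.+ k)) ⟩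
    k/[k] (r ℕ.+ 0)                    ≡⟨ ≡.cong k/[k] (ℕ.+-identityʳ r) ⟩
    k/[k] r                            ∎

  -- Induction on n with r kept general, because the value at n+1 for r is built from the values at
  -- n for both r and r+1.
  β-expansion : ∀ (e : ℕ → ℕ → Carrier) → (∀ r → k/[k] (suc r) ≈ e r 0) →
                (∀ r k → e (suc r) k ≈ p * e r (suc k) + Q k * e r k) →
                ∀ n r → β (suc r) n 0# ≈ ∑[ i ≤ n ] (S₂ n (toℕ i) * e r (toℕ i))
  β-expansion e e-zero e-suc zero r = begin
    β (suc r) 0 0#                                     ≈⟨ β-zero (suc r) ⟩
    k/[k] (suc r)                                      ≈⟨ e-zero r ⟩
    e r 0                                              ≈⟨ ∑S₂-zero (e r) ⟨
    ∑[ i ≤ 0 ] (S₂ 0 (toℕ i) * e r (toℕ i))            ∎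
  β-expansion e e-zero e-suc (suc n) r = begin
    β (suc r) (suc n) 0#                                         ≈⟨ β-step (suc r) n ⟩
    inv q-1#0 * (β (suc (suc r)) n 0# - β (suc r) n 0#)          ≈⟨ *-congˡ (+-cong (β-expansion e e-zero e-suc n (suc r)) (-‿cong (β-expansion e e-zero e-suc n r))) ⟩
    inv q-1#0 * (∑[ k ≤ n ] (S₂ n (toℕ k) * e (suc r) (toℕ k)) - ∑[ k ≤ n ] (S₂ n (toℕ k) * e r (toℕ k)))
                                                                 ≈⟨ ∑S₂-difference n (e-suc r) ⟩
    ∑[ k ≤ suc n ] (S₂ (suc n) (toℕ k) * e r (toℕ k))            ∎

  β≈∑φS₂ : ∀ n r → β (suc r) n 0# ≈ ∑[ i ≤ n ] (S₂ n (toℕ i) * φ (suc r) (toℕ i))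
  β≈∑φS₂ = β-expansion (λ r → φ (suc r)) φ-zero φ-suc

  -- The second expression for φ, by partial fractions.

  -- D r i = q^(-r) (q-1)^i q^(i(i+1)/2 - ir) [r]_i, the coefficient of 1/[k+i+1]
  -- in the second expression for φᵣ₊₁(k); see D-closed.
  D : ℕ → ℕ → Carrier
  D r zero    = Q⁻ r
  D r (suc i) = D r i * (q - Q (suc i) * Q⁻ r)

  -- The last factor is q - q^(r+1) q^(-r) = 0. This removes the boundary term when the sums in
  -- `Ψ-cross` are aligned.
  D-end : ∀ r → D r (suc r) ≈ 0#
  D-end r = begin
    D r r * (q - Q (suc r) * Q⁻ r)     ≈⟨ *-congˡ (+-congˡ (-‿cong (*-congʳ (Q-suc r)))) ⟩
    D r r * (q - q * Q r * Q⁻ r)       ≈⟨ solve 4 (λ d q u v → d :* (q :- q :* u :* v) := d :* q :* (:1 :- u :* v)) refl (D r r) q (Q r) (Q⁻ r) ⟩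
    D r r * q * (1# - Q r * Q⁻ r)      ≈⟨ *-congˡ (+-congˡ (-‿cong (q^-inverse (ι r)))) ⟩
    D r r * q * (1# - 1#)              ≈⟨ solve 2 (λ d q → d :* q :* (:1 :- :1) := :0) refl (D r r) q ⟩
    0#                                 ∎

  -- Since q^(i+2) q^(-r-1) = q^(i+1) q^(-r), both sides acquire the same factor when i grows by
  -- one, so their ratio is fixed by the case i = 0.
  D-shift : ∀ r i → D (suc r) (suc i) ≈ (1# - Q⁻ (suc r)) * D r i
  D-shift r zero = begin
    w * (q - Q 1 * w)                  ≈⟨ *-congˡ (+-congˡ (-‿cong (*-congʳ (trans (Q-suc 0) (*-congˡ (pow-0 q>0)))))) ⟩
    w * (q - q * 1# * w)               ≈⟨ solve 2 (λ q w → w :* (q :- q :* :1 :* w) := (:1 :- w) :* (q :* w)) refl q w ⟩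
    (1# - w) * (q * w)                 ≈⟨ *-congˡ (Q⁻-suc r) ⟩
    (1# - w) * Q⁻ r                    ∎
    where w = Q⁻ (suc r)
  D-shift r (suc i) = begin
    D (suc r) (suc i) * (q - Q (suc (suc i)) * w)      ≈⟨ *-cong (D-shift r i) (+-congˡ (-‿cong (*-congʳ (Q-suc (suc i))))) ⟩
    (1# - w) * D r i * (q - q * Q (suc i) * w)         ≈⟨ solve 4 (λ w d q u → (:1 :- w) :* d :* (q :- q :* u :* w) := (:1 :- w) :* (d :* (q :- u :* (q :* w)))) refl w (D r i) q (Q (suc i)) ⟩
    (1# - w) * (D r i * (q - Q (suc i) * (q * w)))     ≈⟨ *-congˡ (*-congˡ (+-congˡ (-‿cong (*-congˡ (Q⁻-suc r))))) ⟩
    (1# - w) * D r (suc i)                             ∎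
    where w = Q⁻ (suc r)

  D-suc-zero : ∀ r → D (suc r) 0 ≈ Q⁻ 1 * D r 0
  D-suc-zero r = begin
    q^ (- (1# + ι r))        ≈⟨ q^-cong (solve 1 (λ x → :- (:1 :+ x) := :- (:1 :+ :0) :+ :- x) refl (ι r)) ⟩
    q^ (- ι 1 - ι r)         ≈⟨ pow-+ q>0 (- ι 1) (- ι r) ⟩
    Q⁻ 1 * Q⁻ r              ∎

  -- A Pascal-type rule. In `Ψ-cross` it splits each new coefficient of 1/[k+i+2] into a part that
  -- accompanies a term of `Ψ r k` and a part that accompanies a term of `Ψ r (suc k)`.
  D-suc-suc : ∀ r i → D (suc r) (suc i) ≈ Q⁻ (suc (suc i)) * D r (suc i) + (1# - Q⁻ (suc i)) * D r i
  D-suc-suc r i = begin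
    D (suc r) (suc i)                                            ≈⟨ D-shift r i ⟩
    (1# - v) * d                                                 ≈⟨ solve 4 (λ q v d w → (:1 :- v) :* d := d :* (w :* q :- :1 :* v) :+ (:1 :- q :* w) :* d) refl q v d w ⟩
    d * (w * q - 1# * v) + (1# - q * w) * d                      ≈⟨ +-cong (*-congˡ (+-congˡ (-‿cong (*-congʳ unit)))) (*-congʳ (+-congˡ (-‿cong (sym (Q⁻-suc (suc i)))))) ⟨
    d * (w * q - q * u * w * v) + (1# - Q⁻ (suc i)) * d          ≈⟨ +-congʳ (solve 5 (λ q u v w d → d :* (w :* q :- q :* u :* w :* v) := w :* (d :* (q :- u :* (q :* v)))) refl q u v w d) ⟩
    w * (d * (q - u * (q * v))) + (1# - Q⁻ (suc i)) * d          ≈⟨ +-congʳ (*-congˡ (*-congˡ (+-congˡ (-‿cong (*-congˡ (Q⁻-suc r)))))) ⟩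
    w * D r (suc i) + (1# - Q⁻ (suc i)) * d                      ∎
    where
    d = D r i
    u = Q (suc i)
    v = Q⁻ (suc r)
    w = Q⁻ (suc (suc i))
    unit : q * u * w ≈ 1#
    unit = trans (*-congʳ (sym (Q-suc (suc i)))) (q^-inverse (ι (suc (suc i))))

  -- Abstract: conversion checking of the unfolded apartness proofs does not finish.
  abstract
    I : ℕ → Carrier
    I n = inv ([1+n]#0 n)

    I-def : ∀ n → I n ≡ inv ([1+n]#0 n)
    I-def n = ≡.refl

  N*I : ∀ n → N (suc n) * I n ≈ 1#
  N*I n = trans (*-congˡ (reflexive (I-def n))) (*-invʳ ([1+n]#0 n))

  Ψ : ℕ → ℕ → Carrier
  Ψ r k = ∑[ i ≤ r ] (D r (toℕ i) * I (k ℕ.+ toℕ i))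

  -- The numerator is -q^(-i-1) (q^(k+i+1) - 1), a multiple of [k+i+1]. What matters is that the
  -- right-hand side is free of k.
  partial-fraction : ∀ k i → (Q⁻ (suc i) - Q k) * I (k ℕ.+ i) ≈ - (Q⁻ (suc i) * p)
  partial-fraction k i = begin
    (w - u) * x                                  ≈⟨ *-congʳ (solve 2 (λ w u → w :- u := w :- u :* :1) refl w u) ⟩
    (w - u * 1#) * x                             ≈⟨ *-congʳ (+-congˡ (-‿cong (*-congˡ (q^-inverse (ι (suc i)))))) ⟨
    (w - u * (Q (suc i) * w)) * x                ≈⟨ solve 4 (λ w u v x → (w :- u :* (v :* w)) :* x := :- (w :* (u :* v :- :1) :* x)) refl w u (Q (suc i)) x ⟩
    - (w * (u * Q (suc i) - 1#) * x)             ≈⟨ -‿cong (*-congʳ (*-congˡ (trans (p*[] (ι (suc (k ℕ.+ i))))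
                                                      (+-congʳ (trans (reflexive (≡.cong Q (≡.sym (ℕ.+-suc k i)))) (Q-+ k (suc i))))))) ⟨
    - (w * (p * N (suc (k ℕ.+ i))) * x)          ≈⟨ solve 4 (λ w p n x → :- (w :* (p :* n) :* x) := :- (w :* p :* (n :* x))) refl w p (N (suc (k ℕ.+ i))) x ⟩
    - (w * p * (N (suc (k ℕ.+ i)) * x))          ≈⟨ -‿cong (trans (*-congˡ (N*I (k ℕ.+ i))) (*-identityʳ (w * p))) ⟩
    - (w * p)                                    ∎
    where
    u = Q k
    w = Q⁻ (suc i)
    x = I (k ℕ.+ i)

  Ψ-cross : ∀ r k → Ψ (suc r) k ≈ (1# - Q (suc k)) * Ψ r (suc k) + Q k * Ψ r k
  Ψ-cross r k = begin
    D (suc r) 0 * I (k ℕ.+ 0) + ∑[ i ≤ r ] (D (suc r) (suc (toℕ i)) * I (k ℕ.+ suc (toℕ i)))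
      ≈⟨ +-cong (*-congʳ (D-suc-zero r)) (∑-cong (suc r) λ j → trans (*-congʳ (D-suc-suc r j)) (distribʳ (I (k ℕ.+ suc j)) _ _)) ⟩
    a 0 + ∑[ i ≤ r ] (a (suc (toℕ i)) + b (toℕ i))                    ≈⟨ +-congˡ (∑-+ (suc r) (λ j → a (suc j)) b) ⟩
    a 0 + (∑[ i ≤ r ] a (suc (toℕ i)) + ∑[ i ≤ r ] b (toℕ i))         ≈⟨ +-assoc (a 0) _ _ ⟨
    ∑[ i ≤ suc r ] a (toℕ i) + ∑[ i ≤ r ] b (toℕ i)                   ≈⟨ +-congʳ (∑-last-0 (suc r) a a-end) ⟩
    ∑[ i ≤ r ] a (toℕ i) + ∑[ i ≤ r ] b (toℕ i)                       ≈⟨ ∑-+ (suc r) a b ⟨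
    ∑[ i ≤ r ] (a (toℕ i) + b (toℕ i))                                ≈⟨ ∑-cong (suc r) regroup ⟩
    ∑[ i ≤ r ] ((1# - Q (suc k)) * s (suc k) (toℕ i) + Q k * s k (toℕ i))
      ≈⟨ ∑-+ (suc r) (λ j → (1# - Q (suc k)) * s (suc k) j) (λ j → Q k * s k j) ⟩
    ∑[ i ≤ r ] ((1# - Q (suc k)) * s (suc k) (toℕ i)) + ∑[ i ≤ r ] (Q k * s k (toℕ i))
      ≈⟨ +-cong (∑-*ˡ (suc r) (1# - Q (suc k)) (s (suc k))) (∑-*ˡ (suc r) (Q k) (s k)) ⟨
    (1# - Q (suc k)) * Ψ r (suc k) + Q k * Ψ r k                      ∎
    where
    a b : ℕ → Carrier
    a j = Q⁻ (suc j) * D r j * I (k ℕ.+ j)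
    b j = (1# - Q⁻ (suc j)) * D r j * I (k ℕ.+ suc j)
    s : ℕ → ℕ → Carrier
    s k j = D r j * I (k ℕ.+ j)
    a-end : a (suc r) ≈ 0#
    a-end = trans (*-congʳ (trans (*-congˡ (D-end r)) (zeroʳ _))) (zeroˡ _)
    regroup : ∀ j → a j + b j ≈ (1# - Q (suc k)) * s (suc k) j + Q k * s k j
    regroup j = begin
      w * d * x + (1# - w) * d * I (k ℕ.+ suc j)       ≈⟨ +-congˡ (*-congˡ (reflexive (≡.cong I (ℕ.+-suc k j)))) ⟩
      w * d * x + (1# - w) * d * y                     ≈⟨ solve 6 (λ w d x y u u′ → w :* d :* x :+ (:1 :- w) :* d :* y :=
                                                            d :* ((w :- u) :* x) :+ d :* (u :* x :+ (:1 :- w) :* y)) refl w d x y (Q k) (Q (suc k)) ⟩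
      -- The coefficient of `x` should be `Q k`, so the excess `(w - Q k) * x` is exchanged for the
      -- equal quantity `(w - Q (suc k)) * y`; together with `(1# - w) * y` it makes up the wanted
      -- coefficient of `y`.
      d * ((w - Q k) * x) + d * (Q k * x + (1# - w) * y)
                                                       ≈⟨ +-congʳ (*-congˡ (trans (partial-fraction k j) (sym (partial-fraction (suc k) j)))) ⟩
      d * ((w - Q (suc k)) * y) + d * (Q k * x + (1# - w) * y)
                                                       ≈⟨ solve 6 (λ w d x y u u′ → d :* ((w :- u′) :* y) :+ d :* (u :* x :+ (:1 :- w) :* y) :=
                                                            (:1 :- u′) :* (d :* y) :+ u :* (d :* x)) refl w d x y (Q k) (Q (suc k)) ⟩
      (1# - Q (suc k)) * (d * y) + Q k * (d * x)       ∎
      where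
      d = D r j
      w = Q⁻ (suc j)
      x = I (k ℕ.+ j)
      y = I (suc k ℕ.+ j)

  Φ≈Ψ : ∀ r k → Φ (suc r) k ≈ Ψ r k
  Φ≈Ψ zero k = *-cancelˡ-# ([1+n]#0 k) (begin
    N (suc k) * Φ 1 k              ≡⟨ ≡.cong (λ j → N (suc j) * Φ 1 k) (ℕ.+-identityʳ k) ⟨
    N (suc (k ℕ.+ 0)) * Φ 1 k      ≈⟨ Φ-suc 0 k ⟩
    1# + Q k * N 0 * 0#            ≈⟨ trans (+-congˡ (zeroʳ (Q k * N 0))) (+-identityʳ 1#) ⟩
    1#                             ≈⟨ N*I k ⟨
    N (suc k) * I k                ≈⟨ *-congˡ (solve 1 (λ x → x := :1 :* x :+ :0) refl (I k)) ⟩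
    N (suc k) * (1# * I k + 0#)    ≈⟨ *-congˡ (+-congʳ (*-cong q^-0≈1 (reflexive (≡.cong I (ℕ.+-identityʳ k))))) ⟨
    N (suc k) * Ψ 0 k              ∎)
  Φ≈Ψ (suc r) k = begin
    Φ (suc (suc r)) k                                                  ≈⟨ Φ-cross r k ⟩
    (1# - Q (suc k)) * Φ (suc r) (suc k) + Q k * Φ (suc r) k           ≈⟨ +-cong (*-congˡ (Φ≈Ψ r (suc k))) (*-congˡ (Φ≈Ψ r k)) ⟩
    (1# - Q (suc k)) * Ψ r (suc k) + Q k * Ψ r k                       ≈⟨ Ψ-cross r k ⟨
    Ψ (suc r) k                                                        ∎

  -- The exponent of q in `φ′ (suc r)`, with `ι (suc r) - 1#` left unsimplified so that it agrees
  -- with `φ′` by definition.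
  exponent : ℕ → ℕ → Carrier
  exponent r i = ι ((i ℕ.* suc i) div 2) - ι i * (ι (suc r) - 1#)

  q^exponent-suc : ∀ r i → q^ exponent r (suc i) ≈ q^ exponent r i * (Q (suc i) * Q⁻ r)
  q^exponent-suc r i = begin
    q^ (ι ((suc i ℕ.* suc (suc i)) div 2) - ι (suc i) * (ι (suc r) - 1#))
      ≈⟨ q^-cong (+-congʳ (trans (reflexive (≡.cong ι (triangle-suc i))) (×-homo-+ 1# t (suc i)))) ⟩
    q^ ((ι t + ι (suc i)) - ι (suc i) * (ι (suc r) - 1#))
      ≈⟨ q^-cong (solve 3 (λ t i r → (t :+ (:1 :+ i)) :- (:1 :+ i) :* ((:1 :+ r) :- :1) :=
           (t :- i :* ((:1 :+ r) :- :1)) :+ ((:1 :+ i) :+ :- r)) refl (ι t) (ι i) (ι r)) ⟩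
    q^ (exponent r i + (ι (suc i) - ι r))                   ≈⟨ pow-+ q>0 _ _ ⟩
    q^ exponent r i * q^ (ι (suc i) - ι r)                  ≈⟨ *-congˡ (pow-+ q>0 _ _) ⟩
    q^ exponent r i * (Q (suc i) * Q⁻ r)                    ∎
    where t = (i ℕ.* suc i) div 2

  -- Each factor of `D` is q - q^(i+1-r) = q^(i+1-r) (q^(r-i) - 1), that is q^(i+1-r) (q-1) [r-i].
  -- The three pieces build up the power of q, the power of q-1 and the falling factorial.
  D-closed : ∀ r i → D r i ≈ Q⁻ r * (p ^ i * q^ exponent r i * [ ι r ]↓ i)
  D-closed r zero = begin
    Q⁻ r                                                ≈⟨ solve 1 (λ x → x := x :* (:1 :* :1 :* :1)) refl (Q⁻ r) ⟩
    Q⁻ r * (1# * 1# * 1#)                               ≈⟨ *-congˡ (*-congʳ (*-congˡ q^exponent≈1)) ⟨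
    Q⁻ r * (1# * q^ exponent r 0 * 1#)                  ∎
    where
    q^exponent≈1 : q^ exponent r 0 ≈ 1#
    q^exponent≈1 = trans (q^-cong (solve 1 (λ r → :0 :- :0 :* ((:1 :+ r) :- :1) := :0) refl (ι r))) (pow-0 q>0)
  D-closed r (suc i) = begin
    D r i * (q - Q (suc i) * w)                         ≈⟨ *-cong (D-closed r i) factor ⟩
    w * (p ^ i * e * f) * (p * (u * w) * [ ι r - ι i ])
      ≈⟨ solve 7 (λ w x e f p u b → w :* (x :* e :* f) :* (p :* (u :* w) :* b) := w :* (p :* x :* (e :* (u :* w)) :* (f :* b))) refl w (p ^ i) e f p u [ ι r - ι i ] ⟩
    w * (p * p ^ i * (e * (u * w)) * (f * [ ι r - ι i ]))
      ≈⟨ *-congˡ (*-congʳ (*-congˡ (q^exponent-suc r i))) ⟨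
    w * (p * p ^ i * q^ exponent r (suc i) * (f * [ ι r - ι i ]))   ∎
    where
    w = Q⁻ r
    u = Q (suc i)
    e = q^ exponent r i
    f = [ ι r ]↓ i
    factor : q - u * w ≈ p * (u * w) * [ ι r - ι i ]
    factor = begin
      q - u * w                                         ≈⟨ +-congʳ (solve 1 (λ q → q := q :* :1 :* :1) refl q) ⟩
      q * 1# * 1# - u * w                               ≈⟨ +-congʳ (*-cong (*-congˡ (q^-inverse (ι i))) (q^-inverse (ι r))) ⟨
      q * (Q i * Q⁻ i) * (Q r * w) - u * w              ≈⟨ +-congʳ (solve 5 (λ q a b c w → q :* (a :* b) :* (c :* w) := (q :* a) :* w :* (c :* b)) refl q (Q i) (Q⁻ i) (Q r) w) ⟩
      (q * Q i) * w * (Q r * Q⁻ i) - u * w              ≈⟨ +-congʳ (*-cong (*-congʳ (Q-suc i)) (pow-+ q>0 (ι r) (- ι i))) ⟨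
      u * w * q^ (ι r - ι i) - u * w                    ≈⟨ solve 2 (λ x y → x :* y :- x := x :* (y :- :1)) refl (u * w) (q^ (ι r - ι i)) ⟩
      u * w * (q^ (ι r - ι i) - 1#)                     ≈⟨ *-congˡ (p*[] (ι r - ι i)) ⟨
      u * w * (p * [ ι r - ι i ])                       ≈⟨ solve 3 (λ x p b → x :* (p :* b) := p :* x :* b) refl (u * w) p [ ι r - ι i ] ⟩
      p * (u * w) * [ ι r - ι i ]                       ∎

  ↓*! : ∀ {r i} → i ≤ r → [ ι r ]↓ i * [ r ∸ i ]! ≈ [ r ]!
  ↓*! z≤n = *-identityˡ _
  ↓*! {suc r} {suc i} (s≤s i≤r) = begin
    [ ι (suc r) ]↓ suc i * [ r ∸ i ]!             ≈⟨ *-congʳ (↓-suc-suc r i) ⟩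
    N (suc r) * [ ι r ]↓ i * [ r ∸ i ]!           ≈⟨ *-assoc _ _ _ ⟩
    N (suc r) * ([ ι r ]↓ i * [ r ∸ i ]!)         ≈⟨ *-congˡ (↓*! i≤r) ⟩
    N (suc r) * [ r ]!                            ≈⟨ ↓-suc-suc r r ⟨
    [ suc r ]!                                    ∎

  !*inv! : ∀ {r i n} → i ≤ r → n ≡ r ∸ i → [ r ]! * inv ([n]!#0 n) ≈ [ ι r ]↓ i
  !*inv! {r} {i} {n} i≤r ≡.refl = begin
    [ r ]! * x                            ≈⟨ *-congʳ (↓*! i≤r) ⟨
    [ ι r ]↓ i * [ n ]! * x               ≈⟨ *-assoc _ _ _ ⟩
    [ ι r ]↓ i * ([ n ]! * x)             ≈⟨ *-congˡ (*-invʳ ([n]!#0 n)) ⟩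
    [ ι r ]↓ i * 1#                       ≈⟨ *-identityʳ _ ⟩
    [ ι r ]↓ i                            ∎
    where x = inv ([n]!#0 n)

  -- f, y, z are arbitrary so that the apartness proofs inside φ′ are never compared.
  φ′-sum : ∀ r k f (y z : ℕ → Carrier) → (∀ {i} → i ≤ r → f * y i ≈ [ ι r ]↓ i) → (∀ i → I (k ℕ.+ i) ≈ z i) →
           σ k * f * q^ (- ι (suc r) + 1#) * ∑[ i ≤ r ] (p ^ toℕ i
             * q^ (ι ((toℕ i ℕ.* suc (toℕ i)) div 2) - ι (toℕ i) * (ι (suc r) - 1#)) * y (toℕ i) * z (toℕ i))
           ≈ σ k * Ψ r k
  φ′-sum r k f y z fy≈↓ I≈z = begin
    σ k * f * g * ∑[ i ≤ r ] t i                ≈⟨ solve 4 (λ s f g x → s :* f :* g :* x := s :* (f :* g :* x)) refl (σ k) f g (∑[ i ≤ r ] t i) ⟩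
    σ k * (f * g * ∑[ i ≤ r ] t i)              ≈⟨ *-congˡ (*-distribˡ-sum {suc r} (f * g) t) ⟩
    σ k * ∑[ i ≤ r ] (f * g * t i)              ≈⟨ *-congˡ (sum-cong-≋ {suc r} term) ⟩
    σ k * Ψ r k                                 ∎
    where
    g = q^ (- ι (suc r) + 1#)
    t : Fin (suc r) → Carrier
    t i = p ^ toℕ i * q^ exponent r (toℕ i) * y (toℕ i) * z (toℕ i)
    term : ∀ i → f * g * t i ≈ D r (toℕ i) * I (k ℕ.+ toℕ i)
    term i = begin
      f * g * (x * e * y j * z j)                  ≈⟨ *-cong (*-congˡ (q^-cong (solve 1 (λ r → :- r := :- (:1 :+ r) :+ :1) refl (ι r)))) (*-congˡ (I≈z j)) ⟨
      f * Q⁻ r * (x * e * y j * I (k ℕ.+ j))       ≈⟨ solve 6 (λ f w x e y z → f :* w :* (x :* e :* y :* z) := w :* (x :* e :* (f :* y)) :* z) refl f (Q⁻ r) x e (y j) (I (k ℕ.+ j)) ⟩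
      Q⁻ r * (x * e * (f * y j)) * I (k ℕ.+ j)     ≈⟨ *-congʳ (*-congˡ (*-congˡ (fy≈↓ (ℕ.s≤s⁻¹ (toℕ<n i))))) ⟩
      Q⁻ r * (x * e * [ ι r ]↓ j) * I (k ℕ.+ j)    ≈⟨ *-congʳ (D-closed r j) ⟨
      D r j * I (k ℕ.+ j)                          ∎
      where
      j = toℕ i
      x = p ^ j
      e = q^ exponent r j

  φ′≈σΨ : ∀ r k → φ′ (suc r) k ≈ σ k * Ψ r k
  φ′≈σΨ r k = φ′-sum r k [ suc r ∸ 1 ]! (λ i → inv ([n]!#0 (suc r ∸ 1 ∸ i))) (λ i → inv ([1+n]#0 (k ℕ.+ i)))
    (λ i≤r → !*inv! i≤r ≡.refl) (λ i → reflexive (I-def (k ℕ.+ i)))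

theorem2p23 : ∀ {c ℓ₁ ℓ₂} (ℝ : RealNumbers c ℓ₁ ℓ₂) (let open RealNumbers ℝ) →
    (q : Carrier) (q>0 : 0# < q) (q#1 : q # 1#) (let open QAnalogues ℝ q q>0 q#1) →
    (S : ℕ → ℕ → Carrier) → IsqStirling₂ S →
    (r : ℕ) → 1 ≤ r →
    ((n : ℕ) → β r n 0# ≈ ∑[ k ≤ n ] (φ r (toℕ k) * S n (toℕ k)))
    × ((k : ℕ) → φ r k ≈ φ′ r k)
theorem2p23 ℝ q q>0 q#1 S isS (suc r) (s≤s _) =
  (λ n → trans (β≈∑φS₂ n r) (sum-cong-≋ {suc n} (S₂⇒S n)))
  , λ k → trans (*-congˡ (Φ≈Ψ r k)) (sym (φ′≈σΨ r k))
  where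
  open RealNumbers ℝ
  open FieldProperties ℝ
  open Carlitz ℝ q q>0 q#1
  open QAnalogues ℝ q q>0 q#1
  S₂⇒S : ∀ n (i : Fin (suc n)) → S₂ n (toℕ i) * φ (suc r) (toℕ i) ≈ φ (suc r) (toℕ i) * S n (toℕ i)
  -- The exchange is made term by term over `Fin (suc n)`, whose index supplies the bound k ≤ n
  -- under which uniqueness holds.
  S₂⇒S n i = trans (*-comm _ _) (*-congˡ (sym (qStirling₂-unique {S} isS n (toℕ i) (ℕ.s≤s⁻¹ (toℕ<n i)))))
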